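{- Let $n_2,n_3,n_4,n_5,m,w$ be nonnegative integers with $n_2$ even and $n_2\ge 2$. Suppose there are $n_2$ couples (a husband and one wife), $n_3$ triples (a husband and two wives), $n_4$ quadruples (a husband and three wives), $n_5$ pentuples (a husband and four wives), $m$ single men and $w$ single women. The number of ways to seat all these persons around a circular table such that (1) all members of each family sit together, (2) no man sits adjacent to a woman except his own wife/wives, and (3) every husband having more than one wife is surrounded by his wives, is $$(1\cdot 2!)^{n_3}(2\cdot 3!)^{n_4}(3\cdot 4!)^{n_5}\cdot \frac{n_2!}{\left(\frac{n_2}{2}\right)!}\cdot \frac{\left(\frac{n_2}{2}+m-1\right)!}{\left(\frac{n_2}{2}-1\right)!}\cdot \left(\frac{n_2}{2}+n_3+n_4+n_5+w-1\right)!.$$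
   Context: All persons are distinguishable. Every person belongs to exactly one family (couple, triple, quadruple or pentuple) or is a single man or a single woman. The circular table has exactly as many seats as there are persons, and each person occupies one seat. Two seatings are regarded as the same if and only if one is obtained from the other by a rotation of the table; opposite orientations (mirror images) are counted as different. "Adjacent" means occupying cyclically neighbouring seats. Condition (1), "all members of a family sit together", means that the members of each family occupy a set of cyclically consecutive seats. Condition (2) means that whenever a man and a woman are adjacent, the woman is a wife of that man (so in particular single men are never adjacent to a woman, and single women are never adjacent to a man). Condition (3), "surrounded by his wives", means that both neighbours of such a husband are his own wives. -}

module Defs where

open import Data.Fin using (Fin; toℕ)
open import Data.Fin.Properties using (toℕ<n; toℕ-fromℕ<; toℕ-injective)
open import Data.Nat using (ℕ; suc; _+_; _*_; _∸_; _<_; _%_)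
open import Data.Nat.DivMod
  using (_mod_; m%n<n; %-distribˡ-+; m%n%n≡m%n; m<n⇒m%n≡m; [m+kn]%n≡m%n)
open import Data.Nat.Properties using (+-assoc; +-comm; m+[n∸m]≡n; m≤m*n)
open import Data.Product using (∃-syntax; _×_; _,_)
open import Data.Sum using (_⊎_)
open import Function.Bundles using (_↔_; _⇔_; Inverse)
open import Level using (0ℓ)
open import Relation.Binary.Bundles using (Setoid)
open import Relation.Binary.PropositionalEquality
  using (_≡_; refl; sym; trans; cong; setoid; module ≡-Reasoning)

-- The seats of a circular table with N seats are Fin N, numbered cyclically;
-- rotate k i is the seat k places after i.
rotate : ∀ {N} → ℕ → Fin N → Fin N
rotate {suc N} k i = (toℕ i + k) mod suc N

Neighbouring : ∀ {N} → Fin N → Fin N → Set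
Neighbouring i j = j ≡ rotate 1 i ⊎ i ≡ rotate 1 j

toℕ-rotate : ∀ {N} k (i : Fin (suc N)) → toℕ (rotate k i) ≡ (toℕ i + k) % suc N
toℕ-rotate {N} k i = toℕ-fromℕ< (m%n<n (toℕ i + k) (suc N))

rotate-+ : ∀ {N} k l (i : Fin N) → rotate l (rotate k i) ≡ rotate (k + l) i
rotate-+ {suc N} k l i = toℕ-injective (begin
  toℕ (rotate l (rotate k i))          ≡⟨ toℕ-rotate l (rotate k i) ⟩
  (toℕ (rotate k i) + l) % n           ≡⟨ cong (λ x → (x + l) % n) (toℕ-rotate k i) ⟩
  ((toℕ i + k) % n + l) % n            ≡⟨ %-distribˡ-+ ((toℕ i + k) % n) l n ⟩
  ((toℕ i + k) % n % n + l % n) % n    ≡⟨ cong (λ x → (x + l % n) % n) (m%n%n≡m%n (toℕ i + k) n) ⟩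
  ((toℕ i + k) % n + l % n) % n        ≡⟨ %-distribˡ-+ (toℕ i + k) l n ⟨
  (toℕ i + k + l) % n                  ≡⟨ cong (_% n) (+-assoc (toℕ i) k l) ⟩
  (toℕ i + (k + l)) % n                ≡⟨ toℕ-rotate (k + l) i ⟨
  toℕ (rotate (k + l) i)               ∎)
  where
  open ≡-Reasoning
  n : ℕ
  n = suc N

rotate-full : ∀ {N} k (i : Fin N) → rotate (k * N) i ≡ i
rotate-full {suc N} k i = toℕ-injective
  (trans (toℕ-rotate (k * suc N) i)
  (trans ([m+kn]%n≡m%n (toℕ i) k (suc N))
         (m<n⇒m%n≡m (toℕ<n i))))

rotate-inverse : ∀ {N} k (i : Fin N) → rotate (k * N ∸ k) (rotate k i) ≡ i
rotate-inverse {suc N} k i =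
  trans (rotate-+ k (k * suc N ∸ k) i)
  (trans (cong (λ x → rotate x i) (m+[n∸m]≡n (m≤m*n k (suc N))))
         (rotate-full k i))

module Table (n₂ n₃ n₄ n₅ m w : ℕ) where

  data Family : Set where
    couple    : Fin n₂ → Family
    triple    : Fin n₃ → Family
    quadruple : Fin n₄ → Family
    pentuple  : Fin n₅ → Family

  #wives : Family → ℕ
  #wives (couple _)    = 1
  #wives (triple _)    = 2
  #wives (quadruple _) = 3
  #wives (pentuple _)  = 4

  data Person : Set where
    husband     : Family → Person
    wife        : (f : Family) → Fin (#wives f) → Person
    singleMan   : Fin m → Person
    singleWoman : Fin w → Person

  data Man : Person → Set where
    husband   : ∀ f → Man (husband f)
    singleMan : ∀ i → Man (singleMan i)

  data Woman : Person → Set where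
    wife        : ∀ f i → Woman (wife f i)
    singleWoman : ∀ i → Woman (singleWoman i)

  data _MemberOf_ : Person → Family → Set where
    husband : ∀ f → husband f MemberOf f
    wife    : ∀ f i → wife f i MemberOf f

  data _WifeOf_ : Person → Person → Set where
    wife : ∀ f i → wife f i WifeOf husband f

  #persons : ℕ
  #persons = n₂ * 2 + n₃ * 3 + n₄ * 4 + n₅ * 5 + m + w

  Arrangement : Set
  Arrangement = Fin #persons ↔ Person

  module _ (s : Arrangement) where
    open Inverse s using () renaming (to to occupant; from to seatOf)

    Adjacent : Person → Person → Set
    Adjacent p q = Neighbouring (seatOf p) (seatOf q)

    -- The seats taken by f are exactly a, a+1, …, a+#wives f (cyclically).
    SitsTogether : Family → Set
    SitsTogether f = ∃[ a ] ∀ i →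
      occupant i MemberOf f ⇔ (∃[ k ] k < suc (#wives f) × i ≡ rotate k a)

    record Admissible : Set where
      field
        familiesTogether  : ∀ f → SitsTogether f
        onlyOwnWives      : ∀ p q → Man p → Woman q → Adjacent p q → q WifeOf p
        surroundedByWives : ∀ f → 1 < #wives f →
                            ∀ q → Adjacent (husband f) q → q WifeOf husband f

  record Seating : Set where
    field
      arrangement : Arrangement
      admissible  : Admissible arrangement

    open Inverse arrangement public using () renaming (to to occupant; from to seatOf)

  _≈ᵣ_ : Seating → Seating → Set
  s ≈ᵣ t = ∃[ k ] ∀ i → Seating.occupant t i ≡ Seating.occupant s (rotate k i)

  -- Seatings up to rotation; reflections are not identified.
  SeatingsUpToRotation : Setoid 0ℓ 0ℓ
  SeatingsUpToRotation = record
    { Carrier       = Seating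
    ; _≈_           = _≈ᵣ_
    ; isEquivalence = record
      { refl  = λ {s} → 0 , λ i → cong (Seating.occupant s) (sym (rotate-full 0 i))
      ; sym   = λ {s} {t} → ≈ᵣ-sym s t
      ; trans = λ {s} {t} {u} → ≈ᵣ-trans s t u
      }
    }
    where
    ≈ᵣ-sym : ∀ s t → s ≈ᵣ t → t ≈ᵣ s
    ≈ᵣ-sym s t (k , eq) = l , λ i → sym (trans (eq (rotate l i))
      (cong (Seating.occupant s) (trans (rotate-+ l k i)
        (trans (cong (λ x → rotate x i) (+-comm l k))
        (trans (sym (rotate-+ k l i)) (rotate-inverse k i))))))
      where
      l : ℕ
      l = k * #persons ∸ k

    ≈ᵣ-trans : ∀ s t u → s ≈ᵣ t → t ≈ᵣ u → s ≈ᵣ u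
    ≈ᵣ-trans s t u (k , eq) (l , eq′) = l + k , λ i →
      trans (eq′ i) (trans (eq (rotate l i)) (cong (Seating.occupant s) (rotate-+ l k i)))

-- n counts the equivalence classes of S.
HasCardinality : Setoid 0ℓ 0ℓ → ℕ → Set
HasCardinality S n = Inverse S (setoid (Fin n))

{-# OPTIONS --safe #-}
module Submission where

-- In an admissible seating every person belongs either to the women's zone or
-- to the men's zone, the husbands of triples, quadruples and pentuples being
-- enclosed by their wives, and only the couples lie on the border. Reading the
-- circle from couple 0 one alternately visits the two zones, n₂ / 2 times each,
-- and crosses from one to the other at a couple. A seating is thus determined
-- by the orientation of couple 0, the order of the other n₂ − 1 couples, the
-- distribution of the single men over the n₂ / 2 visits to the men's zone, that
-- of the large families and single women over the n₂ / 2 visits to the women's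
-- zone, and the order inside each large family. Distributing k objects over
-- r + 1 sequences means shuffling them into r separators, which can be done in
-- (r + k)! / r! ways: insert one object after the other.

open import Data.Empty using (⊥; ⊥-elim)
open import Data.Fin using (Fin; zero; suc; inject₁; fromℕ; lower₁; toℕ)
open import Data.Fin.Properties
  using (1↔⊤; *↔×; inject₁-lower₁; inject₁-injective; _≟_; toℕ-fromℕ; toℕ-injective; toℕ<n;
         +↔⊎)
  renaming (suc-injective to suc-injectiveᶠ)
open import Data.List.Base as List
  using (List; []; _∷_; [_]; _++_; map; length; concat; concatMap; catMaybes; mapMaybe; allFin;
         _∷ʳ_; initLast; _∷ʳ′_)
open import Data.List.Membership.Propositional using (_∈_; _∉_; find)
open import Data.List.Membership.Propositional.Properties
open import Data.List.Membership.Propositional.Properties.WithK using (unique∧set⇒bag)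
import Data.List.Properties as List
open import Data.List.Relation.Binary.BagAndSetEquality using (∼bag⇒↭)
open import Data.List.Relation.Binary.Permutation.Propositional
  using (_↭_; refl; prep; swap; trans; ↭-sym; ↭-reflexive; ↭-trans; ↭⇒↭ₛ; module PermutationReasoning)
open import Data.List.Relation.Binary.Permutation.Propositional.Properties
  using (++⁺; ++⁺ˡ; shift; shifts; drop-∷; ∈-resp-↭; ↭-length; catMaybes-↭; map⁺; ++-comm;
         mapMaybe-↭)
import Data.List.Relation.Binary.Permutation.Setoid.Properties as Permutationₛ
open import Data.List.Relation.Unary.All as All using (All)
open import Data.List.Relation.Unary.AllPairs using ([]; _∷_)
open import Data.List.Relation.Unary.Any as Any using (here; there)
open import Data.List.Relation.Unary.Unique.Propositional using (Unique)
import Data.List.Relation.Unary.Unique.Propositional.Properties as Unique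
open import Data.Maybe using (Maybe; just; nothing)
open import Data.Maybe.Properties using (just-injective)
open import Data.Nat
  using (ℕ; zero; suc; _+_; _*_; _^_; _∸_; _≤_; _<_; _%_; z≤n; s≤s; z<s; s<s; ⌊_/2⌋; ⌈_/2⌉; _/_; _!)
open import Data.Nat.DivMod using (m%n<n; m<n⇒m%n≡m; m≡m%n+[m/n]*n; m*n/n≡m; m*n/m*o≡n/o; /-congˡ; m/n*n≡m)
open import Data.Nat.Divisibility using (_∣_; divides; ∣n⇒∣m*n; m≤n⇒m!∣n!)
open import Data.Nat.Properties
  using (suc-injective; +-identityʳ; +-comm; <⇒≤; ≤-refl; ≤-trans; n≤1+n; m≤n⇒m≤1+n; <⇒≢; m≤m+n;
         m≤n+m; _<?_; ≮⇒≥; m+[n∸m]≡n; m∸n≤m; ≤-pred; _!≢0; *-assoc; m≤m*n; *-identityʳ; +-assoc)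
open import Data.Nat.Tactic.RingSolver using (solve-∀)
open import Data.Product using (∃-syntax; ∃₂; _×_; _,_; proj₁; proj₂; ∃)
open import Data.Product.Function.NonDependent.Propositional using (_×-↔_)
open import Data.Sum using (_⊎_; inj₁; inj₂; [_,_]′)
open import Data.Sum.Function.Propositional using (_⊎-↔_)
open import Data.Sum.Properties using (inj₁-injective; inj₂-injective)
open import Data.Unit using (⊤; tt)
open import Data.Vec.Base as Vec using (Vec; []; _∷_; insertAt; toList; lookup)
import Data.Vec.Properties as Vec
open import Defs
open import Function using (_∘_; id)
open import Function.Bundles using (_↔_; mk↔ₛ′; Inverse; _⇔_; mk⇔; Equivalence)
open import Function.Properties.Inverse using (↔-refl; ↔-trans)
open import Level using (0ℓ)
open import Relation.Binary.Bundles using (Setoid)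
open import Relation.Binary.PropositionalEquality as ≡ using (_≡_; _≢_; cong; cong₂; subst; sym)
open import Relation.Nullary using (yes; no; contradiction; ¬_)

-- Conditions (2) and (3) amount to one relation, `Compatible`, between the occupants of consecutive
-- seats. Across the boundary of two families it keeps the zone, so a zone can change only inside a
-- family. The block of a large family begins and ends with a wife, because an end seat would give
-- the husband a neighbour from outside; this leaves the couples as the only crossings. Rotations
-- are removed by putting couple 0 on the seats 0 and 1. With at least two couples there are at
-- least four seats, so only the trivial rotation maps two neighbouring seats to themselves, and
-- each class contains exactly one seating of this normal form. The asymmetry of the formula is an
-- artefact of its arithmetic. With r = n₂ / 2 - 1 each zone contributes a quotient (r + k)! / r!.
-- The two orientations of couple 0 and the order of the other couples contribute 2 (2r + 1)!, which
-- equals n₂! / (n₂ / 2)! times r!. The spare r! turns the women's quotient into a full factorial.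

private
  variable
    A B C : Set
    n r N : ℕ

-- Permutations and concatenation

concatMap-↭ : (f : A → List B) {xs ys : List A} → xs ↭ ys → concatMap f xs ↭ concatMap f ys
concatMap-↭ f refl         = refl
concatMap-↭ f (prep x p)   = ++⁺ˡ (f x) (concatMap-↭ f p)
concatMap-↭ f (swap x y p) =
  ↭-trans (shifts (f x) (f y)) (++⁺ˡ (f y) (++⁺ˡ (f x) (concatMap-↭ f p)))
concatMap-↭ f (trans p q)  = ↭-trans (concatMap-↭ f p) (concatMap-↭ f q)

concatMap-cong-↭ : {f g : A → List B} → (∀ x → f x ↭ g x) → ∀ xs → concatMap f xs ↭ concatMap g xs
concatMap-cong-↭ f↭g []       = refl
concatMap-cong-↭ f↭g (x ∷ xs) = ++⁺ (f↭g x) (concatMap-cong-↭ f↭g xs)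

-- A common element of two blocks would force equal labels `g`. The labels are needed because two
-- different entries may have the same block: a couple's two orientations contain the same persons,
-- and `unoriented` serves as label there.
concatMap-unique : (f : A → List B) (g : A → C) → (∀ x → Unique (f x)) →
                   (∀ {x y b} → b ∈ f x → b ∈ f y → g x ≡ g y) →
                   ∀ {xs} → Unique (map g xs) → Unique (concatMap f xs)
concatMap-unique f g f! same {[]}     _                = []
concatMap-unique f g f! same {x ∷ xs} gxs!@(_ ∷ rest!) =
  Unique.++⁺ (f! x) (concatMap-unique f g f! same rest!) disjoint
  where
  disjoint : ∀ {b} → b ∈ f x × b ∈ concatMap f xs → _
  disjoint (b∈fx , b∈rest) with find (∈-concatMap⁻ f {xs = xs} b∈rest)
  ... | y , y∈xs , b∈fy = Unique.Unique[x∷xs]⇒x∉xs gxs!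
    (subst (_∈ map g xs) (sym (same b∈fx b∈fy)) (∈-map⁺ g y∈xs))

toList-surjective : (xs : List A) → length xs ≡ n → ∃[ v ] toList {n = n} v ≡ xs
toList-surjective xs ≡.refl = Vec.fromList xs , Vec.toList∘fromList xs

-- Codings

-- A bijection of `C` with the elements of `B` that satisfy `P`, stated without the subtype. An
-- element can have many proofs of `P`, such as different derivations of one permutation, and a
-- dependent pair would count each of them.
record Coding (C : Set) {B : Set} (P : B → Set) : Set where
  field
    decode    : C → B
    sound     : ∀ c → P (decode c)
    injective : ∀ {c d} → decode c ≡ decode d → c ≡ d
    complete  : ∀ b → P b → ∃[ c ] decode c ≡ b

Vec-coding : {P : B → Set} → Coding C P → Coding (Vec C n) (λ v → ∀ i → P (lookup v i))
Vec-coding {P = P} K = record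
  { decode    = Vec.map decode
  ; sound     = λ v i → subst P (sym (Vec.lookup-map i decode v)) (sound (lookup v i))
  ; injective = map-injective
  ; complete  = map-complete
  }
  where
  open Coding K
  map-injective : ∀ {n} {c d : Vec _ n} → Vec.map decode c ≡ Vec.map decode d → c ≡ d
  map-injective {c = []}     {[]}     _  = ≡.refl
  map-injective {c = c ∷ cs} {d ∷ ds} eq =
    cong₂ _∷_ (injective (Vec.∷-injectiveˡ eq)) (map-injective (Vec.∷-injectiveʳ eq))
  map-complete : ∀ {n} (v : Vec _ n) → (∀ i → P (lookup v i)) → ∃[ c ] Vec.map decode c ≡ v
  map-complete []      _  = [] , ≡.refl
  map-complete (b ∷ v) Pv with complete b (Pv zero) | map-complete v (Pv ∘ suc)
  ... | c , ≡.refl | cs , ≡.refl = c ∷ cs , ≡.refl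

Fin^↔Vec : ∀ {k} → Fin k ↔ C → ∀ n → Fin (k ^ n) ↔ Vec C n
Fin^↔Vec F zero    = ↔-trans 1↔⊤
  (mk↔ₛ′ (λ _ → []) (λ _ → tt) (λ { [] → ≡.refl }) (λ _ → ≡.refl))
Fin^↔Vec F (suc n) = ↔-trans *↔× (↔-trans (F ×-↔ Fin^↔Vec F n)
  (mk↔ₛ′ (λ (c , cs) → c ∷ cs) Vec.uncons (λ { (_ ∷ _) → ≡.refl }) (λ _ → ≡.refl)))

-- Shuffling distinct new letters into a word

toList-insertAt-↭ : (v : Vec A n) (p : Fin (suc n)) (x : A) → toList (insertAt v p x) ↭ x ∷ toList v
toList-insertAt-↭ v       zero    x = refl
toList-insertAt-↭ (y ∷ v) (suc p) x = trans (prep y (toList-insertAt-↭ v p x)) (swap y x refl)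

-- The letter `x` occurs once in the result, so its position and the word left after deleting it can
-- be read off.
insertAt-injective : {x : A} (v w : Vec A n) (p q : Fin (suc n)) → x ∉ toList v → x ∉ toList w →
                     insertAt v p x ≡ insertAt w q x → p ≡ q × v ≡ w
insertAt-injective v       w       zero    zero    _ _ eq = ≡.refl , Vec.∷-injectiveʳ eq
insertAt-injective v       (y ∷ w) zero    (suc q) _ x∉w eq =
  contradiction (here (Vec.∷-injectiveˡ eq)) x∉w
insertAt-injective (y ∷ v) w       (suc p) zero    x∉v _ eq =
  contradiction (here (sym (Vec.∷-injectiveˡ eq))) x∉v
insertAt-injective (y ∷ v) (z ∷ w) (suc p) (suc q) x∉v x∉w eq
  with insertAt-injective v w p q (x∉v ∘ there) (x∉w ∘ there) (Vec.∷-injectiveʳ eq)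
... | p≡q , v≡w = cong suc p≡q , cong₂ _∷_ (Vec.∷-injectiveˡ eq) v≡w

insertAt-surjective : {x : A} (w : Vec A (suc n)) → x ∈ toList w → ∃₂ λ v p → insertAt v p x ≡ w
insertAt-surjective (y ∷ w)     (here ≡.refl) = w , zero , ≡.refl
insertAt-surjective (y ∷ z ∷ w) (there x∈w) with insertAt-surjective (z ∷ w) x∈w
... | v , p , eq = y ∷ v , suc p , cong (y ∷_) eq

-- The product (r + 1)(r + 2) ... (r + k). The factor `suc (k + r)` is the number of gaps in a word
-- that has already received k letters.
rising : ℕ → ℕ → ℕ
rising zero    r = 1
rising (suc k) r = suc (k + r) * rising k r

ShuffleCode : ℕ → ℕ → Set
ShuffleCode zero    r = ⊤
ShuffleCode (suc k) r = Fin (suc (k + r)) × ShuffleCode k r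

Fin↔ShuffleCode : ∀ k r → Fin (rising k r) ↔ ShuffleCode k r
Fin↔ShuffleCode zero    r = 1↔⊤
Fin↔ShuffleCode (suc k) r = ↔-trans *↔× (↔-refl ×-↔ Fin↔ShuffleCode k r)

module _ {A : Set} {r : ℕ} (base : Vec A r) where

  shuffle : (xs : List A) → ShuffleCode (length xs) r → Vec A (length xs + r)
  shuffle []       _       = base
  shuffle (x ∷ xs) (p , c) = insertAt (shuffle xs c) p x

  shuffle-↭ : ∀ xs c → toList (shuffle xs c) ↭ xs ++ toList base
  shuffle-↭ []       _       = refl
  shuffle-↭ (x ∷ xs) (p , c) =
    ↭-trans (toList-insertAt-↭ (shuffle xs c) p x) (prep x (shuffle-↭ xs c))

  shuffle-∉ : ∀ {x} xs c → x ∉ xs → x ∉ toList base → x ∉ toList (shuffle xs c)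
  shuffle-∉ xs c x∉xs x∉base x∈s with ∈-++⁻ xs (∈-resp-↭ (shuffle-↭ xs c) x∈s)
  ... | inj₁ x∈xs   = x∉xs x∈xs
  ... | inj₂ x∈base = x∉base x∈base

  shuffle-injective : ∀ {xs} → Unique xs → (∀ {x} → x ∈ xs → x ∉ toList base) →
                      ∀ {c d} → shuffle xs c ≡ shuffle xs d → c ≡ d
  shuffle-injective {[]}     _               _     _  = ≡.refl
  shuffle-injective {x ∷ xs} xs!@(_ ∷ rest!) fresh {p , c} {q , d} eq
    with insertAt-injective _ _ p q (x∉ c) (x∉ d) eq
    where
    x∉ : ∀ c → x ∉ toList (shuffle xs c)
    x∉ c = shuffle-∉ xs c (Unique.Unique[x∷xs]⇒x∉xs xs!) (fresh (here ≡.refl))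
  ... | p≡q , eq′ = cong₂ _,_ p≡q (shuffle-injective rest! (fresh ∘ there) eq′)

  -- Deleting the letters of `xs` one after the other leaves some rearrangement of `base`; the first
  -- hypothesis identifies it with `base`. It holds for the empty word and for a word of equal
  -- separators, the two bases that occur.
  shuffle-surjective : (∀ v → toList v ↭ toList base → v ≡ base) →
                       ∀ xs w → toList w ↭ xs ++ toList base → ∃[ c ] shuffle xs c ≡ w
  shuffle-surjective rigid []       w w↭ = tt , sym (rigid w w↭)
  shuffle-surjective rigid (x ∷ xs) w w↭ with insertAt-surjective w (∈-resp-↭ (↭-sym w↭) (here ≡.refl))
  ... | v , p , ≡.refl with shuffle-surjective rigid xs v
                              (drop-∷ (↭-trans (↭-sym (toList-insertAt-↭ v p x)) w↭))
  ... | c , ≡.refl = (p , c) , ≡.refl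

ordering-coding : {xs : List A} → Unique xs →
                  Coding (ShuffleCode (length xs) 0) (λ (v : Vec A (length xs + 0)) → toList v ↭ xs)
ordering-coding {xs = xs} xs! = record
  { decode    = shuffle [] xs
  ; sound     = λ c → ↭-trans (shuffle-↭ [] xs c) (↭-reflexive (List.++-identityʳ xs))
  ; injective = shuffle-injective [] xs! (λ _ ())
  ; complete  = λ v v↭ → shuffle-surjective [] (λ { [] _ → ≡.refl }) xs v
                  (↭-trans v↭ (↭-reflexive (sym (List.++-identityʳ xs))))
  }

-- Distributing letters over a sequence of lists: the lists are joined with
-- nothing as separator.

join : Vec (List A) (suc r) → List (Maybe A)
join {r = zero}  (l ∷ [])  = map just l
join {r = suc r} (l ∷ ls)  = map just l ++ nothing ∷ join ls

consFirst : A → Vec (List A) (suc r) → Vec (List A) (suc r)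
consFirst x (l ∷ ls) = (x ∷ l) ∷ ls

-- Surplus separators are dropped, missing ones yield empty lists.
split : ∀ r → List (Maybe A) → Vec (List A) (suc r)
split r       []            = Vec.replicate _ []
split r       (just x  ∷ w) = consFirst x (split r w)
split zero    (nothing ∷ w) = split zero w
split (suc r) (nothing ∷ w) = [] ∷ split r w

nothings : List (Maybe A) → ℕ
nothings []            = 0
nothings (just _  ∷ w) = nothings w
nothings (nothing ∷ w) = suc (nothings w)

nothings-↭ : {w w′ : List (Maybe A)} → w ↭ w′ → nothings w ≡ nothings w′
nothings-↭ refl                        = ≡.refl
nothings-↭ (prep (just _) p)           = nothings-↭ p
nothings-↭ (prep nothing p)            = cong suc (nothings-↭ p)
nothings-↭ (swap (just _) (just _) p)  = nothings-↭ p
nothings-↭ (swap (just _) nothing p)   = cong suc (nothings-↭ p)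
nothings-↭ (swap nothing (just _) p)   = cong suc (nothings-↭ p)
nothings-↭ (swap nothing nothing p)    = cong (2 +_) (nothings-↭ p)
nothings-↭ (trans p q)                 = ≡.trans (nothings-↭ p) (nothings-↭ q)

-- Reduces the claim that a joined sequence of lists is a shuffle to a comparison of letters and a
-- count of separators.
separate-↭ : (w : List (Maybe A)) → w ↭ map just (catMaybes w) ++ List.replicate (nothings w) nothing
separate-↭ []            = refl
separate-↭ (just x  ∷ w) = prep (just x) (separate-↭ w)
separate-↭ (nothing ∷ w) = trans (prep nothing (separate-↭ w))
  (↭-sym (shift nothing (map just (catMaybes w)) _))

join-consFirst : (x : A) (ls : Vec (List A) (suc r)) → join (consFirst x ls) ≡ just x ∷ join ls
join-consFirst {r = zero}  x (l ∷ []) = ≡.refl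
join-consFirst {r = suc r} x (l ∷ ls) = ≡.refl

join-split : ∀ r (w : List (Maybe A)) → nothings w ≡ r → join (split r w) ≡ w
join-split zero    []            _  = ≡.refl
join-split r       (just x  ∷ w) eq =
  ≡.trans (join-consFirst x (split r w)) (cong (just x ∷_) (join-split r w eq))
join-split (suc r) (nothing ∷ w) eq = cong (nothing ∷_) (join-split r w (suc-injective eq))

split-join : (ls : Vec (List A) (suc r)) → split r (join ls) ≡ ls
split-join {r = zero}  ([] ∷ [])      = ≡.refl
split-join {r = zero}  ((x ∷ l) ∷ []) = cong (consFirst x) (split-join (l ∷ []))
split-join {r = suc r} ([] ∷ ls)      = cong ([] ∷_) (split-join ls)
split-join {r = suc r} ((x ∷ l) ∷ ls) = cong (consFirst x) (split-join (l ∷ ls))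

nothings-map-just : (l : List A) (w : List (Maybe A)) → nothings (map just l ++ w) ≡ nothings w
nothings-map-just []      w = ≡.refl
nothings-map-just (x ∷ l) w = nothings-map-just l w

nothings-replicate : ∀ r → nothings {A} (List.replicate r nothing) ≡ r
nothings-replicate zero    = ≡.refl
nothings-replicate (suc r) = cong suc (nothings-replicate r)

nothings-join : (ls : Vec (List A) (suc r)) → nothings (join ls) ≡ r
nothings-join {r = zero}  (l ∷ []) =
  ≡.trans (cong nothings (sym (List.++-identityʳ (map just l)))) (nothings-map-just l [])
nothings-join {r = suc r} (l ∷ ls) =
  ≡.trans (nothings-map-just l (nothing ∷ join ls)) (cong suc (nothings-join ls))

catMaybes-map-just : (l : List A) (w : List (Maybe A)) → catMaybes (map just l ++ w) ≡ l ++ catMaybes w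
catMaybes-map-just []      w = ≡.refl
catMaybes-map-just (x ∷ l) w = cong (x ∷_) (catMaybes-map-just l w)

catMaybes-replicate : ∀ r → catMaybes {A = A} (List.replicate r nothing) ≡ []
catMaybes-replicate zero    = ≡.refl
catMaybes-replicate (suc r) = catMaybes-replicate r

catMaybes-join : (ls : Vec (List A) (suc r)) → catMaybes (join ls) ≡ concat (toList ls)
catMaybes-join {r = zero}  (l ∷ []) =
  ≡.trans (cong catMaybes (sym (List.++-identityʳ (map just l)))) (catMaybes-map-just l [])
catMaybes-join {r = suc r} (l ∷ ls) =
  ≡.trans (catMaybes-map-just l (nothing ∷ join ls)) (cong (l ++_) (catMaybes-join ls))

∈-replicate : ∀ {x y : A} r → x ∈ List.replicate r y → x ≡ y
∈-replicate (suc r) (here eq) = eq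
∈-replicate (suc r) (there p) = ∈-replicate r p

all-equal⇒replicate : {y : A} (v : Vec A r) → (∀ {x} → x ∈ toList v → x ≡ y) → v ≡ Vec.replicate r y
all-equal⇒replicate []      _   = ≡.refl
all-equal⇒replicate (x ∷ v) all =
  cong₂ _∷_ (all (here ≡.refl)) (all-equal⇒replicate v (all ∘ there))

-- A shuffled word contains exactly r separators. On such words `join` undoes `split`, which gives
-- injectivity, and the default clauses of `split` never matter. Conversely every distribution is
-- recovered by splitting its join.
distribution-coding : {xs : List A} → Unique xs → ∀ r →
  Coding (ShuffleCode (length (map just xs)) r)
         (λ (ls : Vec (List A) (suc r)) → concat (toList ls) ↭ xs)
distribution-coding {A = A} {xs = xs} xs! r = record
  { decode    = λ c → split r (word c)
  ; sound     = λ c → ↭-trans (↭-reflexive (≡.trans (sym (catMaybes-join (split r (word c))))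
                                 (cong catMaybes (join-word c))))
                      (↭-trans (catMaybes-↭ (word-↭ c)) (↭-reflexive catMaybes-letters))
  ; injective = λ {c} {d} eq → shuffle-injective separators (Unique.map⁺ just-injective xs!) fresh
                  (≡.trans (sym (Vec.cast-is-id ≡.refl _))
                  (Vec.toList-injective ≡.refl _ _
                    (≡.trans (sym (join-word c)) (≡.trans (cong join eq) (join-word d)))))
  ; complete  = complete
  }
  where
  separators : Vec (Maybe A) r
  separators = Vec.replicate r nothing

  letters : List (Maybe A)
  letters = map just xs ++ List.replicate r nothing

  toList-separators : toList separators ≡ List.replicate r nothing
  toList-separators = Vec.toList-replicate r nothing

  word : ShuffleCode (length (map just xs)) r → List (Maybe A)
  word c = toList (shuffle separators (map just xs) c)

  word-↭ : ∀ c → word c ↭ letters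
  word-↭ c = subst (λ l → word c ↭ map just xs ++ l) toList-separators
                   (shuffle-↭ separators (map just xs) c)

  nothings-letters : nothings letters ≡ r
  nothings-letters = ≡.trans (nothings-map-just xs _) (nothings-replicate r)

  catMaybes-letters : catMaybes letters ≡ xs
  catMaybes-letters = ≡.trans (catMaybes-map-just xs _)
    (≡.trans (cong (xs ++_) (catMaybes-replicate r)) (List.++-identityʳ xs))

  join-word : ∀ c → join (split r (word c)) ≡ word c
  join-word c = join-split r (word c) (≡.trans (nothings-↭ (word-↭ c)) nothings-letters)

  fresh : ∀ {x} → x ∈ map just xs → x ∉ toList separators
  fresh x∈ x∈sep with ∈-map⁻ just x∈ | ∈-replicate r (subst (_ ∈_) toList-separators x∈sep)
  ... | _ , _ , ≡.refl | ()

  rigid : ∀ v → toList v ↭ toList separators → v ≡ separators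
  rigid v v↭ = all-equal⇒replicate v
    (∈-replicate r ∘ subst (_ ∈_) toList-separators ∘ ∈-resp-↭ v↭)

  module _ (ls : Vec (List A) (suc r)) (ls↭ : concat (toList ls) ↭ xs) where
    join-↭ : join ls ↭ map just xs ++ toList separators
    join-↭ = ↭-trans (separate-↭ (join ls)) (++⁺
      (map⁺ just (↭-trans (↭-reflexive (catMaybes-join ls)) ls↭))
      (↭-reflexive (≡.trans (cong (λ k → List.replicate k nothing) (nothings-join ls))
                            (sym toList-separators))))
    join-length : length (join ls) ≡ length (map just xs) + r
    join-length = ≡.trans (↭-length join-↭) (≡.trans (List.length-++ (map just xs))
      (cong (length (map just xs) +_) (Vec.length-toList separators)))

  complete : ∀ ls → concat (toList ls) ↭ xs → ∃[ c ] split r (word c) ≡ ls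
  complete ls ls↭ with toList-surjective (join ls) (join-length ls ls↭)
  ... | v , v≡ with shuffle-surjective separators rigid (map just xs) v
                      (subst (_↭ _) (sym v≡) (join-↭ ls ls↭))
  ... | c , ≡.refl = c , ≡.trans (cong (split r) v≡) (split-join ls)

-- Inserting a separator strictly inside an ordering

insertAt-fromℕ : (v : Vec A n) (x : A) → toList (insertAt v (fromℕ n) x) ≡ toList v ++ [ x ]
insertAt-fromℕ []      x = ≡.refl
insertAt-fromℕ (y ∷ v) x = cong (y ∷_) (insertAt-fromℕ v x)

toList-∷ʳ : (v : Vec A (suc n)) → ∃₂ λ l y → toList v ≡ l ++ [ y ] × y ∈ toList v
toList-∷ʳ (y ∷ [])    = [] , y , ≡.refl , here ≡.refl
toList-∷ʳ (y ∷ z ∷ v) with toList-∷ʳ (z ∷ v)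
... | l , x , eq , x∈ = y ∷ l , x , cong (y ∷_) eq , there x∈

insertAt-inject₁-∷ʳ : (v : Vec A n) (p : Fin n) (x : A) →
                      ∃₂ λ l y → toList (insertAt v (inject₁ p) x) ≡ l ++ [ y ] × y ∈ toList v
insertAt-inject₁-∷ʳ v@(_ ∷ _) zero    x with toList-∷ʳ v
... | l , y , eq , y∈ = x ∷ l , y , cong (x ∷_) eq , y∈
insertAt-inject₁-∷ʳ (z ∷ v) (suc p) x with insertAt-inject₁-∷ʳ v p x
... | l , y , eq , y∈ = z ∷ l , y , cong (z ∷_) eq , there y∈

record Bracketed (xs : List A) (l : List (Maybe A)) : Set where
  constructor bracketed
  field
    {first last} : A
    {front back} : List (Maybe A)
    ordering : l ↭ nothing ∷ map just xs
    starts   : l ≡ just first ∷ back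
    ends     : l ≡ front ++ [ just last ]

-- The k + 1 wives are ordered first; then the husband goes into one of the k gaps between them.
-- `suc` skips the gap in front and `inject₁` the gap at the end. This is the origin of the factors
-- k (k + 1)!, that is 1 · 2!, 2 · 3! and 3 · 4!.
bracketed-coding : {x : A} {xs : List A} → Unique (x ∷ xs) →
  Coding (Fin (length (map just xs) + 0) × ShuffleCode (suc (length (map just xs))) 0)
         (Bracketed (x ∷ xs))
bracketed-coding {A = A} {x} {xs} xs! = record
  { decode    = λ (p , c) → toList (insertAt (Coding.decode K c) (suc (inject₁ p)) nothing)
  ; sound     = sound
  ; injective = injective
  ; complete  = complete
  }
  where
  letters : List (Maybe A)
  letters = map just (x ∷ xs)

  K : Coding (ShuffleCode (length letters) 0) (λ (v : Vec (Maybe A) (length letters + 0)) → toList v ↭ letters)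
  K = ordering-coding (Unique.map⁺ just-injective xs!)
  module K = Coding K

  ∈letters⇒just : ∀ {y} → y ∈ letters → ∃[ a ] y ≡ just a
  ∈letters⇒just y∈ with ∈-map⁻ just y∈
  ... | a , _ , eq = a , eq

  nothing∉ : ∀ c → nothing ∉ toList (K.decode c)
  nothing∉ c n∈ with ∈letters⇒just (∈-resp-↭ (K.sound c) n∈)
  ... | _ , ()

  sound : ∀ ((p , c) : Fin _ × _) → Bracketed (x ∷ xs) (toList (insertAt (K.decode c) (suc (inject₁ p)) nothing))
  sound (p , c) with K.decode c | K.sound c
  ... | y ∷ v | v↭ with insertAt-inject₁-∷ʳ v p nothing
                      | ∈letters⇒just (∈-resp-↭ v↭ (here ≡.refl))
  ... | l , z , eq , z∈ | _ , ≡.refl with ∈letters⇒just (∈-resp-↭ v↭ (there z∈))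
  ... | _ , ≡.refl = bracketed {front = just _ ∷ l}
    (↭-trans (toList-insertAt-↭ (y ∷ v) (suc (inject₁ p)) nothing) (prep nothing v↭))
    ≡.refl (cong (y ∷_) eq)

  injective : ∀ {c d} → _ ≡ _ → c ≡ d
  injective {p , c} {q , d} eq
    with insertAt-injective _ _ (suc (inject₁ p)) (suc (inject₁ q)) (nothing∉ c) (nothing∉ d)
           (≡.trans (sym (Vec.cast-is-id ≡.refl _)) (Vec.toList-injective ≡.refl _ _ eq))
  ... | p≡q , c≡d = cong₂ _,_ (inject₁-injective (suc-injectiveᶠ p≡q)) (K.injective c≡d)

  complete : ∀ l → Bracketed (x ∷ xs) l →
             ∃[ pc ] toList (insertAt (K.decode (proj₂ pc)) (suc (inject₁ (proj₁ pc))) nothing) ≡ l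
  complete l (bracketed l↭ starts ends)
    with toList-surjective l (≡.trans (↭-length l↭) (cong suc (sym (+-identityʳ (length letters)))))
  ... | w , ≡.refl with insertAt-surjective w (∈-resp-↭ (↭-sym l↭) (here ≡.refl))
  ... | y ∷ v , zero  , ≡.refl with () ← starts
  ... | y ∷ v , suc q , ≡.refl with q ≟ fromℕ _
  -- In the last gap `nothing` would be the final entry, against `ends`.
  ... | yes ≡.refl with () ← List.∷ʳ-injectiveʳ (y ∷ toList v) _
                              (≡.trans (sym (insertAt-fromℕ (y ∷ v) nothing)) ends)
  ... | no q≢last with K.complete (y ∷ v) (drop-∷ (↭-trans
                         (↭-sym (toList-insertAt-↭ (y ∷ v) (suc q) nothing)) l↭))
  ... | c , eq = (lower₁ q q≢ , c) , cong toList
                   (cong₂ (λ p v → insertAt v (suc p) nothing) (inject₁-lower₁ q q≢) eq)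
    where
    q≢ : _ ≢ toℕ q
    q≢ n≡q = q≢last (toℕ-injective (≡.trans (sym n≡q) (sym (toℕ-fromℕ _))))

-- Rotations and windows

rotate-0 : (i : Fin N) → rotate 0 i ≡ i
rotate-0 = rotate-full 0

rotate-suc : ∀ k (i : Fin N) → rotate k (rotate 1 i) ≡ rotate (suc k) i
rotate-suc = rotate-+ 1

rotate-suc′ : ∀ k (i : Fin N) → rotate 1 (rotate k i) ≡ rotate (suc k) i
rotate-suc′ k i = ≡.trans (rotate-+ k 1 i) (cong (λ x → rotate x i) (+-comm k 1))

rotate-comm : ∀ k l (i : Fin N) → rotate k (rotate l i) ≡ rotate l (rotate k i)
rotate-comm k l i = ≡.trans (rotate-+ l k i)
  (≡.trans (cong (λ x → rotate x i) (+-comm l k)) (sym (rotate-+ k l i)))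

rotate-injective : ∀ k {i j : Fin N} → rotate k i ≡ rotate k j → i ≡ j
rotate-injective {N} k eq =
  ≡.trans (sym (rotate-inverse k _)) (≡.trans (cong (rotate (k * N ∸ k)) eq) (rotate-inverse k _))

rotate-N : (i : Fin N) → rotate N i ≡ i
rotate-N {N} i = ≡.trans (cong (λ k → rotate k i) (sym (+-identityʳ N))) (rotate-full 1 i)

rotate-back : (i : Fin N) → 2 ≤ N → rotate (N ∸ 2) (rotate 1 (rotate 1 i)) ≡ i
rotate-back {suc (suc N)} i _ = ≡.trans (rotate-suc N (rotate 1 i)) (≡.trans (rotate-suc (suc N) i) (rotate-N i))
rotate-back {suc zero}    i (s≤s ())

rotate-toℕ : (i : Fin (suc N)) → rotate (toℕ i) zero ≡ i
rotate-toℕ i = toℕ-injective (≡.trans (toℕ-rotate (toℕ i) zero) (m<n⇒m%n≡m (toℕ<n i)))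

-- Since `i` is itself a rotation of seat 0 and rotations commute, the comparison can be moved to
-- seat 0, where a rotation by less than N shows its amount.
rotate-cancel : ∀ {k l} {i : Fin N} → k < N → l < N → rotate k i ≡ rotate l i → k ≡ l
rotate-cancel {suc N} {k} {l} {i} k< l< eq =
  ≡.trans (sym (m<n⇒m%n≡m k<)) (≡.trans (≡.trans (sym (toℕ-rotate k zero))
    (≡.trans (cong toℕ from-zero) (toℕ-rotate l zero))) (m<n⇒m%n≡m l<))
  where
  shift-origin : ∀ k → rotate (toℕ i) (rotate {suc N} k zero) ≡ rotate k i
  shift-origin k = ≡.trans (rotate-comm (toℕ i) k zero) (cong (rotate k) (rotate-toℕ i))
  from-zero : rotate {suc N} k zero ≡ rotate l zero
  from-zero = rotate-injective (toℕ i) (≡.trans (shift-origin k) (≡.trans eq (sym (shift-origin l))))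

rotate-reaches : (i j : Fin N) → ∃[ k ] k < N × j ≡ rotate k i
rotate-reaches {suc N} i j = K % suc N , m%n<n K (suc N) , sym (begin
  rotate (K % suc N) i                               ≡⟨ rotate-full (K / suc N) _ ⟨
  rotate (K / suc N * suc N) (rotate (K % suc N) i)  ≡⟨ rotate-+ (K % suc N) _ i ⟩
  rotate (K % suc N + K / suc N * suc N) i           ≡⟨ cong (λ x → rotate x i) (m≡m%n+[m/n]*n K (suc N)) ⟨
  rotate K i                                         ≡⟨ rotate-+ back (toℕ j) i ⟨
  rotate (toℕ j) (rotate back i)                     ≡⟨ cong (rotate (toℕ j) ∘ rotate back) (rotate-toℕ i) ⟨
  rotate (toℕ j) (rotate back (rotate (toℕ i) zero)) ≡⟨ cong (rotate (toℕ j)) (rotate-inverse (toℕ i) zero) ⟩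
  rotate (toℕ j) zero                                ≡⟨ rotate-toℕ j ⟩
  j                                                  ∎)
  where
  open ≡.≡-Reasoning
  -- `back` is `toℕ i` full turns less `toℕ i` steps, which leads from `i` to seat 0; another
  -- `toℕ j` steps lead to `j`. Full turns are then discarded modulo the number of seats.
  back K : ℕ
  back = toℕ i * suc N ∸ toℕ i
  K = back + toℕ j

-- Turns statements about cyclic seats into statements about lists, so that the cyclic structure
-- survives only in the seat where the reading starts.
window : (Fin N → A) → Fin N → ℕ → List A
window occ b zero    = []
window occ b (suc s) = occ b ∷ window occ (rotate 1 b) s

window-+ : (occ : Fin N → A) (b : Fin N) (s t : ℕ) →
           window occ b (s + t) ≡ window occ b s ++ window occ (rotate s b) t
window-+ occ b zero    t = cong (λ b → window occ b t) (sym (rotate-0 b))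
window-+ occ b (suc s) t = cong (occ b ∷_) (≡.trans (window-+ occ (rotate 1 b) s t)
  (cong (λ c → window occ (rotate 1 b) s ++ window occ c t) (rotate-suc s b)))

length-window : (occ : Fin N → A) (b : Fin N) (s : ℕ) → length (window occ b s) ≡ s
length-window occ b zero    = ≡.refl
length-window occ b (suc s) = cong suc (length-window occ (rotate 1 b) s)

∈-window⁺ : (occ : Fin N → A) (b : Fin N) {k s : ℕ} → k < s → occ (rotate k b) ∈ window occ b s
∈-window⁺ occ b z<s       = here (cong occ (rotate-0 b))
∈-window⁺ occ b {suc k} (s<s k<s) = there (subst (λ c → occ c ∈ _) (rotate-suc k b) (∈-window⁺ occ (rotate 1 b) k<s))

∈-window⁻ : (occ : Fin N → A) (b : Fin N) (s : ℕ) {p : A} → p ∈ window occ b s →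
            ∃[ k ] k < s × p ≡ occ (rotate k b)
∈-window⁻ occ b (suc s) (here eq) = 0 , z<s , ≡.trans eq (cong occ (sym (rotate-0 b)))
∈-window⁻ occ b (suc s) (there p∈) with ∈-window⁻ occ (rotate 1 b) s p∈
... | k , k<s , eq = suc k , s<s k<s , ≡.trans eq (cong occ (rotate-suc k b))

window-unique : {occ : Fin N → A} → (∀ {i j} → occ i ≡ occ j → i ≡ j) →
                ∀ b {s} → s ≤ N → Unique (window occ b s)
window-unique occ-inj b {zero}  _  = []
window-unique {N} {occ = occ} occ-inj b {suc s} s≤ =
  All.tabulate fresh ∷ window-unique occ-inj (rotate 1 b) (<⇒≤ s≤)
  where
  fresh : ∀ {p} → p ∈ window occ (rotate 1 b) s → occ b ≢ p
  fresh p∈ ≡.refl with ∈-window⁻ occ (rotate 1 b) s p∈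
  ... | k , k<s , eq with rotate-cancel {k = 0} {suc k} {b} (≤-trans z<s s≤) (≤-trans (s<s k<s) s≤)
                            (≡.trans (rotate-0 b) (≡.trans (occ-inj eq) (rotate-suc k b)))
  ... | ()

∈-full-window : (occ : Fin N → A) (b i : Fin N) → occ i ∈ window occ b N
∈-full-window occ b i with rotate-reaches b i
... | k , k< , eq = subst (λ j → occ j ∈ window occ b _) (sym eq) (∈-window⁺ occ b {k} k<)

window≡toList : (occ : Fin N → A) (b : Fin N) (v : Vec A n) →
                (∀ i → occ (rotate (toℕ i) b) ≡ lookup v i) → window occ b n ≡ toList v
window≡toList occ b []      _  = ≡.refl
window≡toList occ b (x ∷ v) eq = cong₂ _∷_
  (≡.trans (cong occ (sym (rotate-0 b))) (eq zero))
  (window≡toList occ (rotate 1 b) v (λ i → ≡.trans (cong occ (rotate-suc (toℕ i) b)) (eq (suc i))))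

window-lookup : (v : Vec A (suc N)) → window (lookup v) zero (suc N) ≡ toList v
window-lookup v = window≡toList (lookup v) zero v (cong (lookup v) ∘ rotate-toℕ)

window-ext : (occ occ′ : Fin N → A) {b c : Fin N} (s : ℕ) → window occ b s ≡ window occ′ c s →
             ∀ {k} → k < s → occ (rotate k b) ≡ occ′ (rotate k c)
window-ext occ occ′ {b} {c} (suc s) eq {zero} _ =
  ≡.trans (cong occ (rotate-0 b)) (≡.trans (List.∷-injectiveˡ eq) (cong occ′ (sym (rotate-0 c))))
window-ext occ occ′ {b} {c} (suc s) eq {suc k} (s<s k<s) =
  ≡.trans (cong occ (sym (rotate-suc k b)))
  (≡.trans (window-ext occ occ′ s (List.∷-injectiveʳ eq) k<s) (cong occ′ (rotate-suc k c)))

equal-windows⇒rotated : (occ occ′ : Fin N → A) {b c : Fin N} (k : ℕ) → b ≡ rotate k c →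
                        window occ b N ≡ window occ′ c N → ∀ i → occ′ i ≡ occ (rotate k i)
equal-windows⇒rotated {N} occ occ′ {b} {c} k b≡ windows i with rotate-reaches c i
... | j , j< , i≡ = begin
  occ′ i                    ≡⟨ cong occ′ i≡ ⟩
  occ′ (rotate j c)         ≡⟨ window-ext occ occ′ {b} {c} N windows {j} j< ⟨
  occ (rotate j b)          ≡⟨ cong (λ a → occ (rotate j a)) b≡ ⟩
  occ (rotate j (rotate k c)) ≡⟨ cong occ (rotate-comm j k c) ⟩
  occ (rotate k (rotate j c)) ≡⟨ cong (λ a → occ (rotate k a)) i≡ ⟨
  occ (rotate k i)          ∎
  where open ≡.≡-Reasoning

window-cong : (occ occ′ : Fin N → A) (k : ℕ) → (∀ i → occ′ i ≡ occ (rotate k i)) →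
              ∀ b s → window occ′ b s ≡ window occ (rotate k b) s
window-cong occ occ′ k eq b zero    = ≡.refl
window-cong occ occ′ k eq b (suc s) = cong₂ _∷_ (eq b)
  (≡.trans (window-cong occ occ′ k eq (rotate 1 b) s)
           (cong (λ c → window occ c s) (≡.trans (rotate-suc k b) (sym (rotate-suc′ k b)))))

++-cancel : (xs ys : List A) {xs′ ys′ : List A} → length xs ≡ length ys →
            xs ++ xs′ ≡ ys ++ ys′ → xs ≡ ys × xs′ ≡ ys′
++-cancel []       []       _  eq = ≡.refl , eq
++-cancel (x ∷ xs) (y ∷ ys) le eq with ++-cancel xs ys (suc-injective le) (List.∷-injectiveʳ eq)
... | xs≡ys , eq′ = cong₂ _∷_ (List.∷-injectiveˡ eq) xs≡ys , eq′

window-segment : (occ : Fin N → A) (b : Fin N) (s : ℕ) (xs ys zs : List A) →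
                 window occ b s ≡ xs ++ ys ++ zs →
                 window occ (rotate (length xs) b) (length ys) ≡ ys
window-segment occ b s xs ys zs eq = proj₁ (++-cancel _ ys (length-window occ _ _)
  (proj₂ (++-cancel (window occ b (length xs)) xs
  (length-window occ b (length xs))
  (begin
    window occ b (length xs) ++ window occ (rotate (length xs) b) (length ys) ++ window occ d (length zs)
      ≡⟨ cong (window occ b (length xs) ++_) (window-+ occ _ (length ys) (length zs)) ⟨
    window occ b (length xs) ++ window occ (rotate (length xs) b) (length ys + length zs)
      ≡⟨ window-+ occ b (length xs) _ ⟨
    window occ b (length xs + (length ys + length zs))
      ≡⟨ cong (window occ b) total ⟨
    window occ b s
      ≡⟨ eq ⟩
    xs ++ ys ++ zs
      ∎))))
  where
  open ≡.≡-Reasoning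
  d = rotate (length ys) (rotate (length xs) b)
  total : s ≡ length xs + (length ys + length zs)
  total = ≡.trans (sym (length-window occ b s)) (≡.trans (cong length eq)
    (≡.trans (List.length-++ xs) (cong (length xs +_) (List.length-++ ys))))

-- Chains

-- The source stands before the list, while the target is its last entry (or the source, if the list
-- is empty). With this convention chains over successive blocks compose without sharing an entry.
data Chain (R : A → A → Set) : A → List A → A → Set where
  []  : ∀ {x} → Chain R x [] x
  _∷_ : ∀ {x y z ys} → R x y → Chain R y ys z → Chain R x (y ∷ ys) z

module _ {R : A → A → Set} where

  infixr 5 _++ᶜ_
  _++ᶜ_ : ∀ {x y z xs ys} → Chain R x xs y → Chain R y ys z → Chain R x (xs ++ ys) z
  []       ++ᶜ ds = ds
  (r ∷ cs) ++ᶜ ds = r ∷ (cs ++ᶜ ds)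

  chain-window-end : (occ : Fin N → A) (b : Fin N) (s : ℕ) {x y : A} →
                     Chain R x (window occ b (suc s)) y → y ≡ occ (rotate s b)
  chain-window-end occ b zero    (r ∷ []) = cong occ (sym (rotate-0 b))
  chain-window-end occ b (suc s) (r ∷ ch) =
    ≡.trans (chain-window-end occ (rotate 1 b) s ch) (cong occ (rotate-suc s b))

  chain-window-step : (occ : Fin N → A) (c : Fin N) {k s : ℕ} {y : A} →
                      Chain R (occ c) (window occ (rotate 1 c) s) y → k < s →
                      R (occ (rotate k c)) (occ (rotate 1 (rotate k c)))
  chain-window-step occ c (r ∷ ch) z<s = subst (λ d → R (occ d) (occ (rotate 1 d))) (sym (rotate-0 c)) r
  chain-window-step occ c {suc k} (r ∷ ch) (s<s k<s) =
    subst (λ d → R (occ d) (occ (rotate 1 d))) (rotate-suc k c) (chain-window-step occ (rotate 1 c) ch k<s)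

  -- As the end of the chain, `x` must be the occupant of the last seat; as its source, it stands in
  -- front of seat 0. Thus the first link is the one that closes the circle.
  closed-chain : (occ : Fin (suc N) → A) {x : A} → Chain R x (window occ zero (suc N)) x →
                 ∀ i → R (occ i) (occ (rotate 1 i))
  closed-chain {N} occ {x} ch i with rotate-reaches (rotate N zero) i
  ... | k , k<N , ≡.refl = chain-window-step occ (rotate N zero)
    (≡.subst₂ (λ x b → Chain R x (window occ b (suc N)) x′)
      (chain-window-end occ zero N ch)
      (sym (≡.trans (rotate-suc′ N zero) (rotate-N zero)))
      ch) k<N
    where x′ = x

-- Enumerations

enumerations-↭ : {xs ys : List A} → Unique xs → Unique ys → (∀ x → x ∈ xs) → (∀ y → y ∈ ys) → xs ↭ ys
enumerations-↭ xs! ys! ∈xs ∈ys = ∼bag⇒↭ (unique∧set⇒bag xs! ys! (mk⇔ (λ _ → ∈ys _) (λ _ → ∈xs _)))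

∈-toList⇒lookup : (v : Vec A n) {x : A} → x ∈ toList v → ∃[ i ] lookup v i ≡ x
∈-toList⇒lookup (y ∷ v) (here eq) = zero , sym eq
∈-toList⇒lookup (y ∷ v) (there x∈) with ∈-toList⇒lookup v x∈
... | i , eq = suc i , eq

lookup-∈ : (v : Vec A n) (i : Fin n) → lookup v i ∈ toList v
lookup-∈ (x ∷ v) zero    = here ≡.refl
lookup-∈ (x ∷ v) (suc i) = there (lookup-∈ v i)

lookup-injective : (v : Vec A n) → Unique (toList v) → ∀ {i j} → lookup v i ≡ lookup v j → i ≡ j
lookup-injective (x ∷ v) v!@(_ ∷ rest!) {zero}  {zero}  _  = ≡.refl
lookup-injective (x ∷ v) v!@(_ ∷ rest!) {suc i} {suc j} eq = cong suc (lookup-injective v rest! eq)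
lookup-injective (x ∷ v) v!@(_ ∷ rest!) {zero}  {suc j} eq =
  contradiction (subst (_∈ toList v) (sym eq) (lookup-∈ v j)) (Unique.Unique[x∷xs]⇒x∉xs v!)
lookup-injective (x ∷ v) v!@(_ ∷ rest!) {suc i} {zero}  eq =
  contradiction (subst (_∈ toList v) eq (lookup-∈ v i)) (Unique.Unique[x∷xs]⇒x∉xs v!)

enumeration⇒↔ : (v : Vec A n) → Unique (toList v) → (∀ x → x ∈ toList v) → Fin n ↔ A
enumeration⇒↔ v v! ∈v = mk↔ₛ′ (lookup v) index (λ x → proj₂ (∈-toList⇒lookup v (∈v x)))
  (λ i → lookup-injective v v! (proj₂ (∈-toList⇒lookup v (∈v (lookup v i)))))
  where
  index : _ → _
  index x = proj₁ (∈-toList⇒lookup v (∈v x))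

mapMaybe-map-just : (f : B → Maybe A) (g : A → B) → (∀ x → f (g x) ≡ just x) →
                    ∀ xs → mapMaybe f (map g xs) ≡ xs
mapMaybe-map-just f g eq []       = ≡.refl
mapMaybe-map-just f g eq (x ∷ xs) rewrite eq x = cong (x ∷_) (mapMaybe-map-just f g eq xs)

mapMaybe-map-nothing : {C : Set} (f : B → Maybe C) (g : A → B) → (∀ x → f (g x) ≡ nothing) →
                       ∀ xs → mapMaybe f (map g xs) ≡ []
mapMaybe-map-nothing f g eq []       = ≡.refl
mapMaybe-map-nothing f g eq (x ∷ xs) rewrite eq x = mapMaybe-map-nothing f g eq xs

mapMaybe-++ : (f : A → Maybe B) (xs ys : List A) → mapMaybe f (xs ++ ys) ≡ mapMaybe f xs ++ mapMaybe f ys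
mapMaybe-++ f xs ys = ≡.trans (cong catMaybes (List.map-++ f xs ys)) (List.catMaybes-++ (map f xs) (map f ys))

length-concatMap-map : {C : Set} (f : B → List C) (g : A → B) (k : ℕ) → (∀ x → length (f (g x)) ≡ k) →
                       ∀ xs → length (concatMap f (map g xs)) ≡ length xs * k
length-concatMap-map f g k eq []       = ≡.refl
length-concatMap-map f g k eq (x ∷ xs) =
  ≡.trans (List.length-++ (f (g x))) (cong₂ _+_ (eq x) (length-concatMap-map f g k eq xs))

length-concatMap-++ : (f : A → List B) (xs ys : List A) →
                      length (concatMap f (xs ++ ys)) ≡ length (concatMap f xs) + length (concatMap f ys)
length-concatMap-++ f xs ys =
  ≡.trans (cong length (List.concatMap-++ f xs ys)) (List.length-++ (concatMap f xs))

∈-map-∃ : (f : A → B) {xs : List A} {y : B} → y ∈ map f xs → ∃[ x ] x ∈ xs × f x ≡ y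
∈-map-∃ f y∈ with ∈-map⁻ f y∈
... | x , x∈ , eq = x , x∈ , sym eq

Unique-resp-↭ : {xs ys : List A} → xs ↭ ys → Unique xs → Unique ys
Unique-resp-↭ {A} p = Permutationₛ.Unique-resp-↭ (≡.setoid A) (↭⇒↭ₛ p)

Fin⇒≤ : Fin n → ∀ k → k ≤ n * k
Fin⇒≤ {suc n} _ k = m≤m+n k (n * k)

×-coding : {D : Set} {P : A → Set} {Q : B → Set} → Coding C P → Coding D Q →
           Coding (C × D) (λ ((a , b) : A × B) → P a × Q b)
×-coding K L = record
  { decode    = λ (c , d) → K.decode c , L.decode d
  ; sound     = λ (c , d) → K.sound c , L.sound d
  ; injective = λ eq → cong₂ _,_ (K.injective (cong proj₁ eq)) (L.injective (cong proj₂ eq))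
  ; complete  = complete
  }
  where
  module K = Coding K
  module L = Coding L
  complete : ∀ ((a , b) : _ × _) → _ → ∃[ cd ] (K.decode (proj₁ cd) , L.decode (proj₂ cd)) ≡ (a , b)
  complete (a , b) (Pa , Qb) with K.complete a Pa | L.complete b Qb
  ... | c , ≡.refl | d , ≡.refl = (c , d) , ≡.refl

lookup-ext : (u v : Vec A n) → (∀ i → lookup u i ≡ lookup v i) → u ≡ v
lookup-ext u v eq = ≡.trans (sym (Vec.tabulate∘lookup u)) (≡.trans (Vec.tabulate-cong eq) (Vec.tabulate∘lookup v))

-- The points form a transversal: the two hypotheses say that each class contains at most one and at
-- least one of them.
enumeration⇒HasCardinality : (S : Setoid 0ℓ 0ℓ) → Fin n ↔ C → (point : C → Setoid.Carrier S) →
  (∀ {c d} → Setoid._≈_ S (point c) (point d) → c ≡ d) →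
  (∀ s → ∃[ c ] Setoid._≈_ S s (point c)) → HasCardinality S n
enumeration⇒HasCardinality S F point injective surjective = record
  { to        = Inverse.from F ∘ code
  ; from      = point ∘ Inverse.to F
  ; to-cong   = λ {s} {t} s≈t → cong (Inverse.from F)
                  (injective (S.trans (S.sym (has-code s)) (S.trans s≈t (has-code t))))
  ; from-cong = λ { ≡.refl → S.refl }
  ; inverse   = (λ {i} {s} s≈ → ≡.trans
                  (cong (Inverse.from F) (injective (S.trans (S.sym (has-code s)) s≈)))
                  (Inverse.strictlyInverseʳ F i))
              , λ {s} → λ { ≡.refl → S.trans (S.reflexive (cong point (Inverse.strictlyInverseˡ F (code s))))
                                             (S.sym (has-code s)) }
  }
  where
  module S = Setoid S
  code : S.Carrier → _
  code s = proj₁ (surjective s)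
  has-code : ∀ s → s S.≈ point (code s)
  has-code s = proj₂ (surjective s)

rising-! : ∀ k r → rising k r * r ! ≡ (k + r) !
rising-! zero    r = +-identityʳ (r !)
rising-! (suc k) r = ≡.trans (*-assoc (suc (k + r)) (rising k r) (r !)) (cong (suc (k + r) *_) (rising-! k r))

rising-0 : ∀ k → rising k 0 ≡ k !
rising-0 k = ≡.trans (sym (*-identityʳ (rising k 0))) (≡.trans (rising-! k 0) (cong _! (+-identityʳ k)))

-- Zones and tokens

data Zone : Set where
  women men : Zone

other : Zone → Zone
other women = men
other men   = women

-- A symmetric relation is kept beside `other` because the two zones exchange their roles at each
-- crossing, and `other (other z)` does not reduce to `z` for a variable `z`.
data Opposite : Zone → Zone → Set where
  women-men : Opposite women men
  men-women : Opposite men women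

opposite-sym : ∀ {z z′} → Opposite z z′ → Opposite z′ z
opposite-sym women-men = men-women
opposite-sym men-women = women-men

opposite-other : ∀ z → Opposite z (other z)
opposite-other women = women-men
opposite-other men   = men-women

finalZone : Zone → Zone → ℕ → Zone
finalZone z z′ zero    = z
finalZone z z′ (suc n) = finalZone z′ z n

finalZone-even : ∀ z z′ r → finalZone z z′ (r * 2) ≡ z
finalZone-even z z′ zero    = ≡.refl
finalZone-even z z′ (suc r) = finalZone-even z z′ r

-- Here n₂ = 2 (r + 1). Each zone is visited r + 1 times, so r is the number of separators between
-- the visits.
module Circle (r n₃ n₄ n₅ m w : ℕ) where

  open Table (suc r * 2) n₃ n₄ n₅ m w public

  Couple : Set
  Couple = Fin (suc r * 2)

  data Harem : Set where
    triple    : Fin n₃ → Harem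
    quadruple : Fin n₄ → Harem
    pentuple  : Fin n₅ → Harem

  family : Harem → Family
  family (triple i)    = triple i
  family (quadruple i) = quadruple i
  family (pentuple i)  = pentuple i

  Item : Zone → Set
  Item women = Harem ⊎ Fin w
  Item men   = Fin m

  -- cross z c is couple c seated such that the zone z follows it.
  data Token : Set where
    cross : Zone → Couple → Token
    item  : ∀ z → Item z → Token

  -- nothing stands for the husband.
  Order : Family → Set
  Order f = List (Maybe (Fin (#wives f)))

  Orders : Set
  Orders = ∀ h → Order (family h)

  member : (f : Family) → Maybe (Fin (#wives f)) → Person
  member f nothing  = husband f
  member f (just i) = wife f i

  roster : (f : Family) → Order f
  roster f = nothing ∷ map just (allFin (#wives f))

  Permuted : Orders → Set
  Permuted o = ∀ h → o h ↭ roster (family h)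

  expand : Orders → Token → List Person
  expand o (cross women c)       = husband (couple c) ∷ wife (couple c) zero ∷ []
  expand o (cross men c)         = wife (couple c) zero ∷ husband (couple c) ∷ []
  expand o (item women (inj₁ h)) = map (member (family h)) (o h)
  expand o (item women (inj₂ j)) = [ singleWoman j ]
  expand o (item men i)          = [ singleMan i ]

  -- Multisets of persons do not see how a couple is oriented; `cross women c` is the chosen
  -- representative when tokens are compared up to permutation.
  unoriented : Token → Token
  unoriented (cross z c) = cross women c
  unoriented (item z x)  = item z x

  harems : List Harem
  harems = map triple (allFin n₃) ++ map quadruple (allFin n₄) ++ map pentuple (allFin n₅)

  items : ∀ z → List (Item z)
  items women = map inj₁ harems ++ map inj₂ (allFin w)
  items men   = allFin m

  inventory : ∀ z z′ → List Couple → List (Item z) → List (Item z′) → List Token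
  inventory z z′ cs us vs = map (cross women) cs ++ map (item z) us ++ map (item z′) vs

  allTokens : List Token
  allTokens = inventory women men (allFin (suc r * 2)) (items women) (items men)

  -- The reference enumeration: a list seats each person exactly once when it is a permutation of
  -- this one.
  everybody : List Person
  everybody = concatMap (expand (roster ∘ family)) allTokens

  member-injective : ∀ f {x y} → member f x ≡ member f y → x ≡ y
  member-injective f {nothing} {nothing} _      = ≡.refl
  member-injective f {just _}  {just _}  ≡.refl = ≡.refl

  ∈-roster : ∀ f x → x ∈ roster f
  ∈-roster f nothing  = here ≡.refl
  ∈-roster f (just i) = there (∈-map⁺ just (∈-allFin i))

  roster-unique : ∀ f → Unique (roster f)
  roster-unique f = All.tabulate (λ x∈ eq → absurd x∈ eq) ∷ Unique.map⁺ just-injective (Unique.allFin⁺ _)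
    where
    absurd : ∀ {x : Maybe (Fin (#wives f))} → x ∈ map just (allFin (#wives f)) → nothing ≢ x
    absurd x∈ ≡.refl with ∈-map⁻ just x∈
    ... | _ , _ , ()

  member-MemberOf : ∀ f x → member f x MemberOf f
  member-MemberOf f nothing  = husband f
  member-MemberOf f (just i) = wife f i

  MemberOf⇒member : ∀ {p f} → p MemberOf f → ∃[ x ] member f x ≡ p
  MemberOf⇒member (husband f) = nothing , ≡.refl
  MemberOf⇒member (wife f i)  = just i , ≡.refl

  -- Persons and tokens

  token : Family → Token
  token (couple c)    = cross women c
  token (triple i)    = item women (inj₁ (triple i))
  token (quadruple i) = item women (inj₁ (quadruple i))
  token (pentuple i)  = item women (inj₁ (pentuple i))

  token-family : ∀ h → token (family h) ≡ item women (inj₁ h)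
  token-family (triple _)    = ≡.refl
  token-family (quadruple _) = ≡.refl
  token-family (pentuple _)  = ≡.refl

  tokenOf : Person → Token
  tokenOf (husband f)     = token f
  tokenOf (wife f _)      = token f
  tokenOf (singleMan i)   = item men i
  tokenOf (singleWoman j) = item women (inj₂ j)

  ∈-expand⇒tokenOf : ∀ o t {p} → p ∈ expand o t → tokenOf p ≡ unoriented t
  ∈-expand⇒tokenOf o (cross women c) (here ≡.refl)         = ≡.refl
  ∈-expand⇒tokenOf o (cross women c) (there (here ≡.refl)) = ≡.refl
  ∈-expand⇒tokenOf o (cross men c)   (here ≡.refl)         = ≡.refl
  ∈-expand⇒tokenOf o (cross men c)   (there (here ≡.refl)) = ≡.refl
  ∈-expand⇒tokenOf o (item women (inj₁ h)) p∈ with ∈-map⁻ (member (family h)) p∈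
  ... | nothing , _ , ≡.refl = token-family h
  ... | just _  , _ , ≡.refl = token-family h
  ∈-expand⇒tokenOf o (item women (inj₂ j)) (here ≡.refl)   = ≡.refl
  ∈-expand⇒tokenOf o (item men i)          (here ≡.refl)   = ≡.refl

  harems-unique : Unique harems
  harems-unique = Unique.++⁺ (Unique.map⁺ (λ { ≡.refl → ≡.refl }) (Unique.allFin⁺ _))
    (Unique.++⁺ (Unique.map⁺ (λ { ≡.refl → ≡.refl }) (Unique.allFin⁺ _))
                (Unique.map⁺ (λ { ≡.refl → ≡.refl }) (Unique.allFin⁺ _))
                (λ (h∈ , h∈′) → disjoint₄₅ h∈ h∈′))
    (λ (h∈ , h∈′) → disjoint₃ h∈ (∈-++⁻ (map quadruple (allFin n₄)) h∈′))
    where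
    disjoint₄₅ : ∀ {h} → h ∈ map quadruple (allFin n₄) → h ∉ map pentuple (allFin n₅)
    disjoint₄₅ h∈ h∈′ with ∈-map⁻ quadruple h∈ | ∈-map⁻ pentuple h∈′
    ... | _ , _ , ≡.refl | _ , _ , ()
    disjoint₃ : ∀ {h} → h ∈ map triple (allFin n₃) →
                h ∈ map quadruple (allFin n₄) ⊎ h ∈ map pentuple (allFin n₅) → _
    disjoint₃ h∈ (inj₁ h∈′) with ∈-map⁻ triple h∈ | ∈-map⁻ quadruple h∈′
    ... | _ , _ , ≡.refl | _ , _ , ()
    disjoint₃ h∈ (inj₂ h∈′) with ∈-map⁻ triple h∈ | ∈-map⁻ pentuple h∈′
    ... | _ , _ , ≡.refl | _ , _ , ()

  items-unique : ∀ z → Unique (items z)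
  items-unique men   = Unique.allFin⁺ m
  items-unique women = Unique.++⁺ (Unique.map⁺ inj₁-injective harems-unique)
    (Unique.map⁺ inj₂-injective (Unique.allFin⁺ w)) (λ (x∈ , x∈′) → disjoint x∈ x∈′)
    where
    disjoint : ∀ {x : Item women} → x ∈ map inj₁ harems → x ∉ map inj₂ (allFin w)
    disjoint x∈ x∈′ with ∈-map⁻ inj₁ x∈ | ∈-map⁻ inj₂ x∈′
    ... | _ , _ , ≡.refl | _ , _ , ()

  ∈-items : ∀ z x → x ∈ items z
  ∈-items men   i        = ∈-allFin i
  ∈-items women (inj₂ j) = ∈-++⁺ʳ (map inj₁ harems) (∈-map⁺ inj₂ (∈-allFin j))
  ∈-items women (inj₁ h) = ∈-++⁺ˡ (∈-map⁺ inj₁ (∈-harems h))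
    where
    ∈-harems : ∀ h → h ∈ harems
    ∈-harems (triple i)    = ∈-++⁺ˡ (∈-map⁺ triple (∈-allFin i))
    ∈-harems (quadruple i) = ∈-++⁺ʳ (map triple (allFin n₃)) (∈-++⁺ˡ (∈-map⁺ quadruple (∈-allFin i)))
    ∈-harems (pentuple i)  = ∈-++⁺ʳ (map triple (allFin n₃))
      (∈-++⁺ʳ (map quadruple (allFin n₄)) (∈-map⁺ pentuple (∈-allFin i)))

  ∈-allTokens-cross : ∀ c → cross women c ∈ allTokens
  ∈-allTokens-cross c = ∈-++⁺ˡ (∈-map⁺ (cross women) (∈-allFin c))

  ∈-allTokens-item : ∀ z x → item z x ∈ allTokens
  ∈-allTokens-item women x = ∈-++⁺ʳ (map (cross women) (allFin _)) (∈-++⁺ˡ (∈-map⁺ (item women) (∈-items women x)))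
  ∈-allTokens-item men   x = ∈-++⁺ʳ (map (cross women) (allFin _))
    (∈-++⁺ʳ (map (item women) (items women)) (∈-map⁺ (item men) (∈-items men x)))

  allTokens-unique : Unique allTokens
  allTokens-unique = Unique.++⁺ (Unique.map⁺ (λ { ≡.refl → ≡.refl }) (Unique.allFin⁺ _))
    (Unique.++⁺ (Unique.map⁺ (λ { ≡.refl → ≡.refl }) (items-unique women))
                (Unique.map⁺ (λ { ≡.refl → ≡.refl }) (items-unique men))
                (λ (t∈ , t∈′) → disjoint t∈ t∈′))
    (λ (t∈ , t∈′) → disjoint-cross t∈ (∈-++⁻ (map (item women) (items women)) t∈′))
    where
    disjoint : ∀ {t} → t ∈ map (item women) (items women) → t ∉ map (item men) (items men)
    disjoint t∈ t∈′ with ∈-map⁻ (item women) t∈ | ∈-map⁻ (item men) t∈′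
    ... | _ , _ , ≡.refl | _ , _ , ()
    disjoint-cross : ∀ {t} → t ∈ map (cross women) (allFin _) →
                     t ∈ map (item women) (items women) ⊎ t ∈ map (item men) (items men) → _
    disjoint-cross t∈ (inj₁ t∈′) with ∈-map⁻ (cross women) t∈ | ∈-map⁻ (item women) t∈′
    ... | _ , _ , ≡.refl | _ , _ , ()
    disjoint-cross t∈ (inj₂ t∈′) with ∈-map⁻ (cross women) t∈ | ∈-map⁻ (item men) t∈′
    ... | _ , _ , ≡.refl | _ , _ , ()

  map-unoriented-allTokens : map unoriented allTokens ≡ allTokens
  map-unoriented-allTokens = List.map-id-local (All.tabulate fixed)
    where
    fixed : ∀ {t} → t ∈ allTokens → unoriented t ≡ t
    fixed {cross women c} _ = ≡.refl
    fixed {item z x}      _ = ≡.refl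
    fixed {cross men c}   t∈ with ∈-++⁻ (map (cross women) (allFin _)) t∈
    ... | inj₁ t∈′ with ∈-map⁻ (cross women) t∈′
    ... | _ , _ , ()
    fixed {cross men c}   t∈ | inj₂ t∈′ with ∈-++⁻ (map (item women) (items women)) t∈′
    ... | inj₁ t∈″ with ∈-map⁻ (item women) t∈″
    ... | _ , _ , ()
    fixed {cross men c}   t∈ | inj₂ t∈′ | inj₂ t∈″ with ∈-map⁻ (item men) t∈″
    ... | _ , _ , ()

  length-everybody : length everybody ≡ #persons
  length-everybody = begin
    # (map (cross women) (allFin (suc r * 2)) ++ map (item women) (items women) ++ map (item men) (allFin m))
      ≡⟨ length-concatMap-++ E (map (cross women) (allFin _)) _ ⟩
    # (map (cross women) (allFin (suc r * 2))) + # (map (item women) (items women) ++ map (item men) (allFin m))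
      ≡⟨ cong₂ _+_ (over-allFin (cross women) 2 (λ _ → ≡.refl))
                   (length-concatMap-++ E (map (item women) (items women)) _) ⟩
    suc r * 2 * 2 + (# (map (item women) (items women)) + # (map (item men) (allFin m)))
      ≡⟨ cong (suc r * 2 * 2 +_) (cong₂ _+_ women-length (over-allFin (item men) 1 (λ _ → ≡.refl))) ⟩
    suc r * 2 * 2 + (n₃ * 3 + (n₄ * 4 + n₅ * 5) + w * 1 + m * 1)
      ≡⟨ regroup (suc r * 2 * 2) (n₃ * 3) (n₄ * 4) (n₅ * 5) w m ⟩
    #persons ∎
    where
    open ≡.≡-Reasoning
    E : Token → List Person
    E = expand (roster ∘ family)
    # : List Token → ℕ
    # ts = length (concatMap E ts)
    over-allFin : ∀ {k} (g : Fin k → Token) l → (∀ x → length (E (g x)) ≡ l) → # (map g (allFin k)) ≡ k * l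
    over-allFin {k} g l eq = ≡.trans (length-concatMap-map E g l eq (allFin k))
      (cong (_* l) (List.length-tabulate {n = k} id))
    over-harems : ∀ {k} (g : Fin k → Harem) l → (∀ x → length (E (item women (inj₁ (g x)))) ≡ l) →
                  # (map (item women ∘ inj₁) (map g (allFin k))) ≡ k * l
    over-harems {k} g l eq = ≡.trans (cong # (sym (List.map-∘ {g = item women ∘ inj₁} {f = g} (allFin k))))
      (over-allFin (item women ∘ inj₁ ∘ g) l eq)
    harems-length : # (map (item women ∘ inj₁) harems) ≡ n₃ * 3 + (n₄ * 4 + n₅ * 5)
    harems-length = ≡.trans (cong # (List.map-++ _ (map triple (allFin n₃)) _))
      (≡.trans (length-concatMap-++ E (map (item women ∘ inj₁) (map triple (allFin n₃))) _)
      (cong₂ _+_ (over-harems triple 3 (λ _ → ≡.refl))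
      (≡.trans (cong # (List.map-++ _ (map quadruple (allFin n₄)) _))
      (≡.trans (length-concatMap-++ E (map (item women ∘ inj₁) (map quadruple (allFin n₄))) _)
      (cong₂ _+_ (over-harems quadruple 4 (λ _ → ≡.refl)) (over-harems pentuple 5 (λ _ → ≡.refl)))))))
    women-length : # (map (item women) (items women)) ≡ n₃ * 3 + (n₄ * 4 + n₅ * 5) + w * 1
    women-length = ≡.trans (cong # (List.map-++ (item women) (map inj₁ harems) _))
      (≡.trans (length-concatMap-++ E (map (item women) (map inj₁ harems)) _)
      (cong₂ _+_ (≡.trans (cong # (sym (List.map-∘ harems))) harems-length)
                 (≡.trans (cong # (sym (List.map-∘ {g = item women} {f = inj₂} (allFin w))))
                          (over-allFin (item women ∘ inj₂) 1 (λ _ → ≡.refl)))))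
    regroup : ∀ a b c d e f → a + (b + (c + d) + e * 1 + f * 1) ≡ a + b + c + d + f + e
    regroup = solve-∀

  expand-unique : ∀ t → Unique (expand (roster ∘ family) t)
  expand-unique (cross women c)       = ((λ ()) All.∷ All.[]) ∷ All.[] ∷ []
  expand-unique (cross men c)         = ((λ ()) All.∷ All.[]) ∷ All.[] ∷ []
  expand-unique (item women (inj₁ h)) =
    Unique.map⁺ (member-injective (family h)) (roster-unique (family h))
  expand-unique (item women (inj₂ j)) = All.[] ∷ []
  expand-unique (item men i)          = All.[] ∷ []

  everybody-unique : Unique everybody
  everybody-unique = concatMap-unique (expand (roster ∘ family)) unoriented expand-unique
    (λ {t} {u} p∈t p∈u →
      ≡.trans (sym (∈-expand⇒tokenOf (roster ∘ family) t p∈t)) (∈-expand⇒tokenOf (roster ∘ family) u p∈u))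
    {xs = allTokens}
    (subst Unique (sym map-unoriented-allTokens) allTokens-unique)

  token-∈-allTokens : ∀ f → token f ∈ allTokens
  token-∈-allTokens (couple c)    = ∈-allTokens-cross c
  token-∈-allTokens (triple i)    = ∈-allTokens-item women (inj₁ (triple i))
  token-∈-allTokens (quadruple i) = ∈-allTokens-item women (inj₁ (quadruple i))
  token-∈-allTokens (pentuple i)  = ∈-allTokens-item women (inj₁ (pentuple i))

  ∈-everybody : ∀ p → p ∈ everybody
  ∈-everybody p = ∈-concatMap⁺ (expand (roster ∘ family)) {xs = allTokens}
    (Any.map (λ { ≡.refl → ∈-expand p }) (tokenOf-∈ p))
    where
    ∈-expand : ∀ p → p ∈ expand (roster ∘ family) (tokenOf p)
    ∈-expand (husband (couple c))    = here ≡.refl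
    ∈-expand (husband (triple _))    = here ≡.refl
    ∈-expand (husband (quadruple _)) = here ≡.refl
    ∈-expand (husband (pentuple _))  = here ≡.refl
    ∈-expand (wife (couple c) zero)  = there (here ≡.refl)
    ∈-expand (wife f@(triple _) i)    = ∈-map⁺ (member f) (∈-roster f (just i))
    ∈-expand (wife f@(quadruple _) i) = ∈-map⁺ (member f) (∈-roster f (just i))
    ∈-expand (wife f@(pentuple _) i)  = ∈-map⁺ (member f) (∈-roster f (just i))
    ∈-expand (singleMan i)           = here ≡.refl
    ∈-expand (singleWoman j)         = here ≡.refl
    tokenOf-∈ : ∀ p → tokenOf p ∈ allTokens
    tokenOf-∈ (husband f)     = token-∈-allTokens f
    tokenOf-∈ (wife f _)      = token-∈-allTokens f
    tokenOf-∈ (singleMan i)   = ∈-allTokens-item men i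
    tokenOf-∈ (singleWoman j) = ∈-allTokens-item women (inj₂ j)

  expand-↭ : ∀ {o} → Permuted o → ∀ t → expand o t ↭ expand (roster ∘ family) (unoriented t)
  expand-↭ o↭ (cross women c)       = refl
  expand-↭ o↭ (cross men c)         = swap _ _ refl
  expand-↭ o↭ (item women (inj₁ h)) = map⁺ (member (family h)) (o↭ h)
  expand-↭ o↭ (item women (inj₂ j)) = refl
  expand-↭ o↭ (item men i)          = refl

  concatMap-expand-↭ : ∀ {o ts} → Permuted o → map unoriented ts ↭ allTokens →
                       concatMap (expand o) ts ↭ everybody
  concatMap-expand-↭ {o} {ts} o↭ ts↭ = begin
    concatMap (expand o) ts                                  ↭⟨ concatMap-cong-↭ (expand-↭ o↭) ts ⟩
    concatMap (expand (roster ∘ family) ∘ unoriented) ts     ≡⟨ List.concatMap-map _ unoriented ts ⟨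
    concatMap (expand (roster ∘ family)) (map unoriented ts) ↭⟨ concatMap-↭ _ ts↭ ⟩
    everybody                                                ∎
    where open PermutationReasoning

  -- Selects one person from each block, the husband in the case of a family. The multiset of tokens
  -- can thereby be recovered from the multiset of persons.
  representative : Person → Maybe Token
  representative (husband f)     = just (token f)
  representative (wife _ _)      = nothing
  representative (singleMan i)   = just (item men i)
  representative (singleWoman j) = just (item women (inj₂ j))

  representatives-expand : ∀ {o} → Permuted o → ∀ t → mapMaybe representative (expand o t) ↭ [ unoriented t ]
  representatives-expand o↭ (cross women c)       = refl
  representatives-expand o↭ (cross men c)         = refl
  representatives-expand o↭ (item women (inj₁ h)) =
    ↭-trans (mapMaybe-↭ representative (map⁺ (member (family h)) (o↭ h)))
    (↭-reflexive (cong₂ _∷_ (token-family h) (≡.trans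
      (cong (mapMaybe representative) (sym (List.map-∘ {g = member (family h)} {f = just} (allFin (#wives (family h))))))
      (mapMaybe-map-nothing representative (member (family h) ∘ just) (λ _ → ≡.refl) (allFin (#wives (family h)))))))
  representatives-expand o↭ (item women (inj₂ j)) = refl
  representatives-expand o↭ (item men i)          = refl

  representatives : ∀ {o} → Permuted o → ∀ ts →
                    mapMaybe representative (concatMap (expand o) ts) ↭ map unoriented ts
  representatives o↭ []       = refl
  representatives {o} o↭ (t ∷ ts) = ↭-trans (↭-reflexive (mapMaybe-++ representative (expand o t) _))
    (++⁺ (representatives-expand o↭ t) (representatives o↭ ts))

  tokens-↭ : ∀ {o ts} → Permuted o → concatMap (expand o) ts ↭ everybody → map unoriented ts ↭ allTokens
  tokens-↭ {o} {ts} o↭ p = begin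
    map unoriented ts                                 ↭⟨ representatives o↭ ts ⟨
    mapMaybe representative (concatMap (expand o) ts) ↭⟨ mapMaybe-↭ representative p ⟩
    mapMaybe representative everybody                 ↭⟨ representatives (λ _ → refl) allTokens ⟩
    map unoriented allTokens                          ≡⟨ map-unoriented-allTokens ⟩
    allTokens                                         ∎
    where open PermutationReasoning

  -- Itineraries

  -- us are the visits to zone z, vs those to zone z′, starting in z.
  itinerary : ∀ z z′ → Vec Couple n → Vec (List (Item z)) (suc ⌊ n /2⌋) → Vec (List (Item z′)) ⌈ n /2⌉ →
              List Token
  itinerary z z′ []       (u ∷ []) [] = map (item z) u
  itinerary z z′ (c ∷ cs) (u ∷ us) vs = map (item z) u ++ cross z′ c ∷ itinerary z′ z cs vs us

  circuit : ∀ z z′ → Couple → Vec Couple n → Vec (List (Item z)) (suc ⌊ n /2⌋) → Vec (List (Item z′)) ⌈ n /2⌉ →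
            List Token
  circuit z z′ c cs us vs = cross z c ∷ itinerary z z′ cs us vs

  map-unoriented-items : ∀ z us → map unoriented (map (item z) us) ≡ map (item z) us
  map-unoriented-items z us = sym (List.map-∘ us)

  unoriented-itinerary : ∀ z z′ (cs : Vec Couple n) us vs → map unoriented (itinerary z z′ cs us vs) ↭
    inventory z z′ (toList cs) (concat (toList us)) (concat (toList vs))
  unoriented-itinerary z z′ []       (u ∷ []) [] = ↭-reflexive (≡.trans (map-unoriented-items z u)
    (≡.trans (cong (map (item z)) (sym (List.++-identityʳ u))) (sym (List.++-identityʳ _))))
  unoriented-itinerary z z′ (c ∷ cs) (u ∷ us) vs = begin
    map unoriented (map (item z) u ++ cross z′ c ∷ itinerary z′ z cs vs us)
      ≡⟨ List.map-++ unoriented (map (item z) u) _ ⟩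
    map unoriented (map (item z) u) ++ X ∷ map unoriented (itinerary z′ z cs vs us)
      ≡⟨ cong (λ l → l ++ X ∷ map unoriented (itinerary z′ z cs vs us)) (map-unoriented-items z u) ⟩
    U ++ X ∷ map unoriented (itinerary z′ z cs vs us)
      ↭⟨ shift X U _ ⟩
    X ∷ U ++ map unoriented (itinerary z′ z cs vs us)
      ↭⟨ prep X (++⁺ˡ U (unoriented-itinerary z′ z cs vs us)) ⟩
    X ∷ U ++ CS ++ V ++ U′
      ↭⟨ prep X (shifts U CS) ⟩
    X ∷ CS ++ U ++ V ++ U′
      ↭⟨ prep X (++⁺ˡ CS (++⁺ˡ U (++-comm V U′))) ⟩
    X ∷ CS ++ U ++ U′ ++ V
      ≡⟨ cong (λ l → X ∷ CS ++ l) (List.++-assoc U U′ V) ⟨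
    X ∷ CS ++ (U ++ U′) ++ V
      ≡⟨ cong (λ l → X ∷ CS ++ l ++ V) (List.map-++ (item z) u (concat (toList us))) ⟨
    X ∷ CS ++ map (item z) (u ++ concat (toList us)) ++ V ∎
    where
    open PermutationReasoning
    X : Token
    X = cross women c
    U CS V U′ : List Token
    U  = map (item z) u
    CS = map (cross women) (toList cs)
    V  = map (item z′) (concat (toList vs))
    U′ = map (item z) (concat (toList us))

  allTokens-↭ : ∀ {z z′} → Opposite z z′ → allTokens ↭ inventory z z′ (allFin _) (items z) (items z′)
  allTokens-↭ women-men = refl
  allTokens-↭ men-women = ++⁺ˡ (map (cross women) (allFin _)) (++-comm (map (item women) (items women)) _)

  inventory-↭ : ∀ z z′ {cs cs′ us us′ vs vs′} → cs ↭ cs′ → us ↭ us′ → vs ↭ vs′ →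
                inventory z z′ cs us vs ↭ inventory z z′ cs′ us′ vs′
  inventory-↭ z z′ p q s = ++⁺ (map⁺ _ p) (++⁺ (map⁺ _ q) (map⁺ _ s))

  coupleOf : Token → Maybe Couple
  coupleOf (cross _ c) = just c
  coupleOf (item _ _)  = nothing

  itemOf : ∀ z → Token → Maybe (Item z)
  itemOf women (item women x) = just x
  itemOf men   (item men x)   = just x
  itemOf _     _              = nothing

  itemOf-item : ∀ z x → itemOf z (item z x) ≡ just x
  itemOf-item women x = ≡.refl
  itemOf-item men   x = ≡.refl

  itemOf-cross : ∀ z c → itemOf z (cross women c) ≡ nothing
  itemOf-cross women c = ≡.refl
  itemOf-cross men   c = ≡.refl

  itemOf-opposite : ∀ {z z′} → Opposite z z′ → ∀ x → itemOf z (item z′ x) ≡ nothing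
  itemOf-opposite women-men x = ≡.refl
  itemOf-opposite men-women x = ≡.refl

  module _ {z z′} (opp : Opposite z z′) (cs : List Couple) (us : List (Item z)) (vs : List (Item z′)) where

    mapMaybe-inventory : (f : Token → Maybe A) → mapMaybe f (inventory z z′ cs us vs) ≡
      mapMaybe f (map (cross women) cs) ++ mapMaybe f (map (item z) us) ++ mapMaybe f (map (item z′) vs)
    mapMaybe-inventory f = ≡.trans (mapMaybe-++ f (map (cross women) cs) _)
      (cong (mapMaybe f (map (cross women) cs) ++_) (mapMaybe-++ f (map (item z) us) _))

    couples-inventory : mapMaybe coupleOf (inventory z z′ cs us vs) ≡ cs
    couples-inventory = ≡.trans (mapMaybe-inventory coupleOf) (≡.trans (cong₂ _++_
      (mapMaybe-map-just coupleOf (cross women) (λ _ → ≡.refl) cs) (cong₂ _++_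
      (mapMaybe-map-nothing coupleOf (item z) (λ _ → ≡.refl) us)
      (mapMaybe-map-nothing coupleOf (item z′) (λ _ → ≡.refl) vs)))
      (List.++-identityʳ cs))

    items-inventory : mapMaybe (itemOf z) (inventory z z′ cs us vs) ≡ us
    items-inventory = ≡.trans (mapMaybe-inventory (itemOf z)) (≡.trans (cong₂ _++_
      (mapMaybe-map-nothing (itemOf z) (cross women) (itemOf-cross z) cs) (cong₂ _++_
      (mapMaybe-map-just (itemOf z) (item z) (itemOf-item z) us)
      (mapMaybe-map-nothing (itemOf z) (item z′) (itemOf-opposite opp) vs)))
      (List.++-identityʳ us))

    other-items-inventory : mapMaybe (itemOf z′) (inventory z z′ cs us vs) ≡ vs
    other-items-inventory = ≡.trans (mapMaybe-inventory (itemOf z′)) (cong₂ _++_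
      (mapMaybe-map-nothing (itemOf z′) (cross women) (itemOf-cross z′) cs) (cong₂ _++_
      (mapMaybe-map-nothing (itemOf z′) (item z) (itemOf-opposite (opposite-sym opp)) us)
      (mapMaybe-map-just (itemOf z′) (item z′) (itemOf-item z′) vs)))

  -- The partial projections `coupleOf` and `itemOf` respect permutations and each keeps just one of
  -- the three kinds of tokens.
  inventory-↭⁻ : ∀ {z z′ cs us vs} → Opposite z z′ → inventory z z′ cs us vs ↭ allTokens →
                 cs ↭ allFin _ × us ↭ items z × vs ↭ items z′
  inventory-↭⁻ {z} {z′} {cs} {us} {vs} opp p =
    ≡.subst₂ _↭_ (couples-inventory opp cs us vs) (couples-inventory opp (allFin _) (items z) (items z′))
      (mapMaybe-↭ coupleOf p′) ,
    ≡.subst₂ _↭_ (items-inventory opp cs us vs) (items-inventory opp (allFin _) (items z) (items z′))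
      (mapMaybe-↭ (itemOf z) p′) ,
    ≡.subst₂ _↭_ (other-items-inventory opp cs us vs) (other-items-inventory opp (allFin _) (items z) (items z′))
      (mapMaybe-↭ (itemOf z′) p′)
    where
    p′ : inventory z z′ cs us vs ↭ inventory z z′ (allFin _) (items z) (items z′)
    p′ = ↭-trans p (allTokens-↭ opp)

  -- Injectivity

  item-injective : ∀ {z x y} → item z x ≡ item z y → x ≡ y
  item-injective ≡.refl = ≡.refl

  -- The first crossing is the first token that is no item, so it marks the end of the visit on both
  -- sides.
  items-then-cross-injective : ∀ {z z′ c d ts us} (xs ys : List (Item z)) →
    map (item z) xs ++ cross z′ c ∷ ts ≡ map (item z) ys ++ cross z′ d ∷ us → xs ≡ ys × c ≡ d × ts ≡ us
  items-then-cross-injective []       []       ≡.refl = ≡.refl , ≡.refl , ≡.refl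
  items-then-cross-injective (x ∷ xs) (y ∷ ys) eq
    with item-injective (List.∷-injectiveˡ eq) | items-then-cross-injective xs ys (List.∷-injectiveʳ eq)
  ... | ≡.refl | ≡.refl , c≡d , ts≡us = ≡.refl , c≡d , ts≡us

  itinerary-injective : ∀ z z′ (cs ds : Vec Couple n) {us us′ vs vs′} →
    itinerary z z′ cs us vs ≡ itinerary z z′ ds us′ vs′ → cs ≡ ds × us ≡ us′ × vs ≡ vs′
  itinerary-injective z z′ []       []       {u ∷ []} {u′ ∷ []} {[]} {[]} eq =
    ≡.refl , cong (_∷ []) (List.map-injective item-injective eq) , ≡.refl
  itinerary-injective z z′ (c ∷ cs) (d ∷ ds) {u ∷ us} {u′ ∷ us′} eq
    with items-then-cross-injective u u′ eq
  ... | ≡.refl , ≡.refl , eq′ with itinerary-injective z′ z cs ds eq′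
  ... | ≡.refl , ≡.refl , ≡.refl = ≡.refl , ≡.refl , ≡.refl

  -- Meant for the first person of a block: a leading wife of a couple means that men follow, a
  -- leading husband that women follow. In a large family any member identifies the token.
  orientedTokenOf : Person → Token
  orientedTokenOf (wife (couple c) _) = cross men c
  orientedTokenOf p                   = tokenOf p

  Bracketing : Orders → Set
  Bracketing o = ∀ h → Bracketed (allFin (#wives (family h))) (o h)

  bracketing⇒permuted : ∀ {o} → Bracketing o → Permuted o
  bracketing⇒permuted b h = Bracketed.ordering (b h)

  expand-head : ∀ {o} → Bracketing o → ∀ t → ∃₂ λ p ps → expand o t ≡ p ∷ ps × orientedTokenOf p ≡ t
  expand-head b (cross women c)       = _ , _ , ≡.refl , ≡.refl
  expand-head b (cross men c)         = _ , _ , ≡.refl , ≡.refl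
  expand-head b (item women (inj₂ j)) = _ , _ , ≡.refl , ≡.refl
  expand-head b (item men i)          = _ , _ , ≡.refl , ≡.refl
  expand-head {o} b (item women (inj₁ h)) = _ , _ , cong (map (member (family h))) (Bracketed.starts (b h)) , lead h _
    where
    lead : ∀ h i → orientedTokenOf (wife (family h) i) ≡ item women (inj₁ h)
    lead (triple _)    _ = ≡.refl
    lead (quadruple _) _ = ≡.refl
    lead (pentuple _)  _ = ≡.refl

  expand-length : ∀ {o o′} → Permuted o → Permuted o′ → ∀ t → length (expand o t) ≡ length (expand o′ t)
  expand-length o↭ o′↭ t = ≡.trans (↭-length (expand-↭ o↭ t)) (sym (↭-length (expand-↭ o′↭ t)))

  -- The first person determines the first token, and the token determines the length of its block
  -- whatever the orders are. The block can therefore be cancelled on both sides.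
  concatMap-expand-injective : ∀ {o o′} → Bracketing o → Bracketing o′ → ∀ ts us →
    concatMap (expand o) ts ≡ concatMap (expand o′) us →
    ts ≡ us × (∀ {t} → t ∈ ts → expand o t ≡ expand o′ t)
  concatMap-expand-injective b b′ []       []       _  = ≡.refl , λ ()
  concatMap-expand-injective b b′ []       (u ∷ us) eq with expand-head b′ u
  ... | p , ps , u≡ , _ rewrite u≡ with () ← eq
  concatMap-expand-injective b b′ (t ∷ ts) []       eq with expand-head b t
  ... | p , ps , t≡ , _ rewrite t≡ with () ← eq
  concatMap-expand-injective {o} {o′} b b′ (t ∷ ts) (u ∷ us) eq = by-cases t≡u
    where
    t≡u : t ≡ u
    t≡u with expand-head b t | expand-head b′ u
    ... | p , ps , t≡ , pt | q , qs , u≡ , qu rewrite t≡ | u≡ =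
      ≡.trans (sym pt) (≡.trans (cong orientedTokenOf (List.∷-injectiveˡ eq)) qu)
    by-cases : t ≡ u → t ∷ ts ≡ u ∷ us × (∀ {x} → x ∈ t ∷ ts → expand o x ≡ expand o′ x)
    by-cases ≡.refl with ++-cancel (expand o t) (expand o′ t)
                           (expand-length (bracketing⇒permuted b) (bracketing⇒permuted b′) t) eq
    ... | same , eq′ with concatMap-expand-injective b b′ ts us eq′
    ... | ≡.refl , all = ≡.refl , λ { (here ≡.refl) → same ; (there x∈) → all x∈ }

  -- The seating conditions as a relation between neighbours

  data PlainMan : Person → Set where
    husband   : ∀ c → PlainMan (husband (couple c))
    singleMan : ∀ i → PlainMan (singleMan i)

  Belongs : Zone → Person → Set
  Belongs women = Woman
  Belongs men   = PlainMan

  -- The pairs of neighbours that (2) and (3) permit. A husband of several wives is no `PlainMan`,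
  -- so his neighbours can only be his wives.
  data Compatible (p q : Person) : Set where
    bothWomen : Woman p → Woman q → Compatible p q
    bothMen   : PlainMan p → PlainMan q → Compatible p q
    wed       : q WifeOf p → Compatible p q
    wed˘      : p WifeOf q → Compatible p q

  compatible-sym : ∀ {p q} → Compatible p q → Compatible q p
  compatible-sym (bothWomen p q) = bothWomen q p
  compatible-sym (bothMen p q)   = bothMen q p
  compatible-sym (wed q)         = wed˘ q
  compatible-sym (wed˘ p)        = wed p

  several-wives : ∀ h → 1 < #wives (family h)
  several-wives (triple _)    = s≤s (s≤s z≤n)
  several-wives (quadruple _) = s≤s (s≤s z≤n)
  several-wives (pentuple _)  = s≤s (s≤s z≤n)

  wife-MemberOf : ∀ {p f} → p WifeOf husband f → p MemberOf f
  wife-MemberOf (wife f i) = wife f i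

  MemberOf-unique : ∀ {p f g} → p MemberOf f → p MemberOf g → f ≡ g
  MemberOf-unique (husband f) (husband .f) = ≡.refl
  MemberOf-unique (wife f i)  (wife .f .i) = ≡.refl

  data Kind : Person → Set where
    woman     : ∀ {p} → Woman p → Kind p
    plainMan  : ∀ {p} → PlainMan p → Kind p
    polygamist : ∀ h → Kind (husband (family h))

  kind : ∀ p → Kind p
  kind (husband (couple c))    = plainMan (husband c)
  kind (husband (triple i))    = polygamist (triple i)
  kind (husband (quadruple i)) = polygamist (quadruple i)
  kind (husband (pentuple i))  = polygamist (pentuple i)
  kind (wife f i)              = woman (wife f i)
  kind (singleMan i)           = plainMan (singleMan i)
  kind (singleWoman j)         = woman (singleWoman j)

  plainMan⇒man : ∀ {p} → PlainMan p → Man p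
  plainMan⇒man (husband c)   = husband (couple c)
  plainMan⇒man (singleMan i) = singleMan i

  polygamist-not-plain : ∀ h → ¬ PlainMan (husband (family h))
  polygamist-not-plain (triple _)    ()
  polygamist-not-plain (quadruple _) ()
  polygamist-not-plain (pentuple _)  ()

  module _ (s : Arrangement) where
    open Inverse s using (strictlyInverseˡ; strictlyInverseʳ) renaming (to to occ; from to seatOf)

    occ-injective : ∀ {i j} → occ i ≡ occ j → i ≡ j
    occ-injective {i} {j} eq = ≡.trans (sym (strictlyInverseʳ i)) (≡.trans (cong seatOf eq) (strictlyInverseʳ j))

    admissible⇒compatible : Admissible s → ∀ i → Compatible (occ i) (occ (rotate 1 i))
    admissible⇒compatible adm i = compatible (occ i) (occ (rotate 1 i)) (inj₁ next) (inj₂ next)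
      where
      open Admissible adm
      next : seatOf (occ (rotate 1 i)) ≡ rotate 1 (seatOf (occ i))
      next = ≡.trans (strictlyInverseʳ _) (cong (rotate 1) (sym (strictlyInverseʳ i)))
      compatible : ∀ p q → Adjacent s p q → Adjacent s q p → Compatible p q
      compatible p q pq qp with kind p | kind q
      ... | polygamist h | _            = wed (surroundedByWives (family h) (several-wives h) q pq)
      ... | woman _      | polygamist h = wed˘ (surroundedByWives (family h) (several-wives h) p qp)
      ... | plainMan _   | polygamist h = wed˘ (surroundedByWives (family h) (several-wives h) p qp)
      ... | woman p!     | woman q!     = bothWomen p! q!
      ... | plainMan p!  | plainMan q!  = bothMen p! q!
      ... | plainMan p!  | woman q!     = wed (onlyOwnWives p q (plainMan⇒man p!) q! pq)
      ... | woman p!     | plainMan q!  = wed˘ (onlyOwnWives q p (plainMan⇒man q!) p! qp)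

    compatible⇒admissible : (∀ i → Compatible (occ i) (occ (rotate 1 i))) → (∀ f → SitsTogether s f) → Admissible s
    compatible⇒admissible compatible together = record
      { familiesTogether  = together
      ; onlyOwnWives      = λ p q man woman adj → only man woman (adjacent adj)
      ; surroundedByWives = λ f 1<f q adj → surrounded 1<f (adjacent adj)
      }
      where
      next : ∀ {p q} → seatOf q ≡ rotate 1 (seatOf p) → Compatible p q
      next {p} {q} eq = ≡.subst₂ Compatible (strictlyInverseˡ p)
        (≡.trans (cong occ (sym eq)) (strictlyInverseˡ q)) (compatible (seatOf p))
      adjacent : ∀ {p q} → Adjacent s p q → Compatible p q
      adjacent (inj₁ eq) = next eq
      adjacent (inj₂ eq) = compatible-sym (next eq)
      only : ∀ {p q} → Man p → Woman q → Compatible p q → q WifeOf p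
      only _           _ (wed wf)               = wf
      only (husband _)   _ (bothWomen () _)
      only (singleMan _) _ (bothWomen () _)
      only _ (wife _ _)      (bothMen _ ())
      only _ (singleWoman _) (bothMen _ ())
      only (husband _)   (wife _ _)      (wed˘ ())
      only (husband _)   (singleWoman _) (wed˘ ())
      only (singleMan _) (wife _ _)      (wed˘ ())
      only (singleMan _) (singleWoman _) (wed˘ ())
      surrounded : ∀ {f q} → 1 < #wives f → Compatible (husband f) q → q WifeOf husband f
      surrounded _         (wed wf)                = wf
      surrounded (s≤s ()) (bothMen (husband c) _)

    -- `SitsTogether` in terms of persons and windows, the form in which the blocks of a token list
    -- present themselves.
    Contiguous : Family → Fin #persons → Set
    Contiguous f a = ∀ p → p ∈ window occ a (suc (#wives f)) ⇔ p MemberOf f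

    contiguous⇒together : ∀ f a → Contiguous f a → SitsTogether s f
    contiguous⇒together f a contiguous = a , λ i → mk⇔ (to i) (from i)
      where
      to : ∀ i → occ i MemberOf f → ∃[ k ] k < suc (#wives f) × i ≡ rotate k a
      to i i∈f with ∈-window⁻ occ a (suc (#wives f)) (Equivalence.from (contiguous (occ i)) i∈f)
      ... | k , k< , eq = k , k< , occ-injective eq
      from : ∀ i → ∃[ k ] k < suc (#wives f) × i ≡ rotate k a → occ i MemberOf f
      from _ (k , k< , ≡.refl) = Equivalence.to (contiguous _) (∈-window⁺ occ a k<)

    together⇒contiguous : ∀ f → ((a , _) : SitsTogether s f) → Contiguous f a
    together⇒contiguous f (a , iff) p = mk⇔ to from
      where
      to : p ∈ window occ a (suc (#wives f)) → p MemberOf f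
      to p∈ with ∈-window⁻ occ a (suc (#wives f)) p∈
      ... | k , k< , ≡.refl = Equivalence.from (iff _) (k , k< , ≡.refl)
      from : p MemberOf f → p ∈ window occ a (suc (#wives f))
      from p∈f with Equivalence.to (iff (seatOf p)) (subst (_MemberOf f) (sym (strictlyInverseˡ p)) p∈f)
      ... | k , k< , eq = subst (_∈ window occ a (suc (#wives f)))
        (≡.trans (cong occ (sym eq)) (strictlyInverseˡ p)) (∈-window⁺ occ a k<)

  -- From itineraries to seatings

  wives-chain : ∀ {f p} l → nothings l ≡ 0 → Woman p →
                ∃[ q ] Chain Compatible p (map (member f) l) q × Woman q
  wives-chain []           _  p = _ , [] , p
  wives-chain (just i ∷ l) eq p with wives-chain l eq (wife _ i)
  ... | q , ch , wq = q , bothWomen p (wife _ i) ∷ ch , wq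

  -- When the husband is reached, the person before him is a wife by the invariant on `p`. Somebody
  -- follows him because the list does not end with `nothing`, and this is a wife because there is
  -- only one `nothing`.
  family-chain : ∀ {f p front last} l → nothings l ≡ 1 → l ≡ front ++ [ just last ] →
                 p WifeOf husband f → ∃[ q ] Chain Compatible p (map (member f) l) q × Woman q
  family-chain {front = []}    (just i ∷ []) () _ _
  family-chain {front = _ ∷ _} (just i ∷ l)  eq ends (wife f j)
    with family-chain l eq (List.∷-injectiveʳ ends) (wife f i)
  ... | q , ch , wq = q , bothWomen (wife f j) (wife f i) ∷ ch , wq
  family-chain {front = []}    (nothing ∷ l) eq ()  _
  family-chain {front = _ ∷ []} (nothing ∷ []) eq ()  _
  family-chain {front = _ ∷ _ ∷ _} (nothing ∷ []) eq ()  _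
  family-chain {front = _ ∷ _} (nothing ∷ just i ∷ l) eq ends (wife f j)
    with wives-chain {f} l (suc-injective eq) (wife f i)
  ... | q , ch , wq = q , wed˘ (wife f j) ∷ wed (wife f i) ∷ ch , wq

  bracketed-chain : ∀ {f l p} → Bracketed (allFin (#wives f)) l → Woman p →
                    ∃[ q ] Chain Compatible p (map (member f) l) q × Woman q
  bracketed-chain {f} (bracketed {first = i} l↭ ≡.refl ends) p
    -- The first wife serves as her own predecessor to satisfy the invariant of `family-chain`; that
    -- artificial first link is then replaced by the link from the actual predecessor.
    with family-chain {f} (just i ∷ _) one ends (wife f i)
    where
    one = ≡.trans (nothings-↭ l↭) (cong suc (≡.trans
      (cong nothings (sym (List.++-identityʳ (map just (allFin (#wives f)))))) (nothings-map-just (allFin (#wives f)) [])))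
  ... | q , _ ∷ ch , wq = q , bothWomen p (wife f i) ∷ ch , wq

  entry exit : Token → Zone
  entry (cross z _) = other z
  entry (item z _)  = z
  exit (cross z _) = z
  exit (item z _)  = z

  module _ {o : Orders} (b : Bracketing o) where

    token-chain : ∀ t {p} → Belongs (entry t) p →
                  ∃[ q ] Chain Compatible p (expand o t) q × Belongs (exit t) q
    token-chain (cross women c)       p = _ , bothMen p (husband c) ∷ wed (wife _ zero) ∷ [] , wife _ zero
    token-chain (cross men c)         p = _ , bothWomen p (wife _ zero) ∷ wed˘ (wife _ zero) ∷ [] , husband c
    token-chain (item women (inj₁ h)) p = bracketed-chain (b h) p
    token-chain (item women (inj₂ j)) p = _ , bothWomen p (singleWoman j) ∷ [] , singleWoman j
    token-chain (item men i)          p = _ , bothMen p (singleMan i) ∷ [] , singleMan i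

    record Path (z z′ : Zone) (ts : List Token) : Set where
      constructor path
      field
        walk : ∀ {p} → Belongs z p → ∃[ q ] Chain Compatible p (concatMap (expand o) ts) q × Belongs z′ q
    open Path

    token-path : ∀ t {z ts} → Path (exit t) z ts → Path (entry t) z (t ∷ ts)
    walk (token-path t π) p with token-chain t p
    ... | _ , ch , q with walk π q
    ... | _ , ch′ , q′ = _ , ch ++ᶜ ch′ , q′

    items-path : ∀ {z z′ ts} us → Path z z′ ts → Path z z′ (map (item z) us ++ ts)
    items-path []       π = π
    items-path (u ∷ us) π = token-path (item _ u) (items-path us π)

    cross-path : ∀ {z z′ z″ ts} → Opposite z z′ → ∀ c → Path z′ z″ ts → Path z z″ (cross z′ c ∷ ts)
    cross-path women-men c = token-path (cross men c)
    cross-path men-women c = token-path (cross women c)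

    itinerary-path : ∀ {z z′} → Opposite z z′ → (cs : Vec Couple n) → ∀ us vs →
                     Path z (finalZone z z′ n) (itinerary z z′ cs us vs)
    itinerary-path {z = z} opp [] (u ∷ []) [] = subst (Path z z) (List.++-identityʳ _)
      (items-path u (path (λ p → _ , [] , p)))
    itinerary-path opp (c ∷ cs) (u ∷ us) vs =
      items-path u (cross-path opp c (itinerary-path (opposite-sym opp) cs vs us))

  -- The person before seat 0 is the last one of the walk, unknown until the walk is complete. The
  -- walk therefore starts from an arbitrary person of the right zone, and `reclose` exchanges the
  -- first link afterwards.
  inhabitant : ∀ z → ∃ (Belongs z)
  inhabitant women = _ , wife (couple zero) zero
  inhabitant men   = _ , husband zero

  rechain : ∀ {p p′ q x xs} → Compatible p′ x → Chain Compatible p (x ∷ xs) q → Chain Compatible p′ (x ∷ xs) q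
  rechain r (_ ∷ ch) = r ∷ ch

  reclose : ∀ {o z z′ p q ts} → Opposite z z′ → ∀ c → Chain Compatible p (concatMap (expand o) (cross z c ∷ ts)) q →
            Belongs z′ q → Chain Compatible q (concatMap (expand o) (cross z c ∷ ts)) q
  reclose women-men c ch q = rechain (bothMen q (husband c)) ch
  reclose men-women c ch q = rechain (bothWomen q (wife (couple c) zero)) ch

  unoriented⁻-cross : ∀ t {c} → unoriented t ≡ cross women c → ∃[ z ] t ≡ cross z c
  unoriented⁻-cross (cross z c) ≡.refl = z , ≡.refl

  unoriented⁻-item : ∀ t {z x} → unoriented t ≡ item z x → t ≡ item z x
  unoriented⁻-item (item z x) eq = eq

  token-∈ : ∀ {ts} → map unoriented ts ↭ allTokens → ∀ f → ∃[ t ] t ∈ ts × unoriented t ≡ token f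
  token-∈ ts↭ f = ∈-map-∃ unoriented (∈-resp-↭ (↭-sym ts↭) (token-∈-allTokens f))

  module _ {o : Orders} (o↭ : Permuted o) where

    Spells : Token → Family → Set
    Spells t f = (∀ p → p ∈ expand o t ⇔ p MemberOf f) × length (expand o t) ≡ suc (#wives f)

    cross-spells : ∀ z c → Spells (cross z c) (couple c)
    cross-spells women c = (λ p → mk⇔
      (λ { (here ≡.refl) → husband _ ; (there (here ≡.refl)) → wife _ zero })
      (λ { (husband _) → here ≡.refl ; (wife _ zero) → there (here ≡.refl) })) , ≡.refl
    cross-spells men c = (λ p → mk⇔
      (λ { (here ≡.refl) → wife _ zero ; (there (here ≡.refl)) → husband _ })
      (λ { (husband _) → there (here ≡.refl) ; (wife _ zero) → here ≡.refl })) , ≡.refl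

    harem-spells : ∀ h → Spells (item women (inj₁ h)) (family h)
    harem-spells h = (λ p → mk⇔ (to p) (from p)) ,
      ≡.trans (List.length-map _ (o h)) (≡.trans (↭-length (o↭ h))
        (cong suc (≡.trans (List.length-map just (allFin (#wives (family h))))
                           (List.length-tabulate {n = #wives (family h)} id))))
      where
      f = family h
      to : ∀ p → p ∈ map (member f) (o h) → p MemberOf f
      to p p∈ with ∈-map⁻ (member f) p∈
      ... | x , _ , ≡.refl = member-MemberOf f x
      from : ∀ p → p MemberOf f → p ∈ map (member f) (o h)
      from p p∈f with MemberOf⇒member p∈f
      ... | x , ≡.refl = ∈-map⁺ (member f) (∈-resp-↭ (↭-sym (o↭ h)) (∈-roster f x))

    spells : ∀ t f → unoriented t ≡ token f → Spells t f
    spells t (couple c) eq with unoriented⁻-cross t eq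
    ... | z , ≡.refl = cross-spells z c
    spells t (triple i)    eq rewrite unoriented⁻-item t eq = harem-spells (triple i)
    spells t (quadruple i) eq rewrite unoriented⁻-item t eq = harem-spells (quadruple i)
    spells t (pentuple i)  eq rewrite unoriented⁻-item t eq = harem-spells (pentuple i)

  -- The hypothesis on `finalZone` says that the walk ends in the zone from which couple 0 is
  -- entered, so that the chain of compatible neighbours closes around the table.
  realise : ∀ {o z z′} → Bracketing o → Opposite z z′ → (cs : Vec Couple n) → ∀ us vs →
            finalZone z z′ n ≡ z′ → map unoriented (circuit z z′ zero cs us vs) ↭ allTokens →
            ∃[ s ] window (Seating.occupant s) zero #persons ≡ concatMap (expand o) (circuit z z′ zero cs us vs)
  realise {n} {o} {z} {z′} b opp cs us vs final ts↭ =
    record { arrangement = s ; admissible = compatible⇒admissible s compatible together } , window-s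
    where
    o↭ : Permuted o
    o↭ = bracketing⇒permuted b
    ts : List Token
    ts = circuit z z′ zero cs us vs
    persons : List Person
    persons = concatMap (expand o) ts
    persons↭ : persons ↭ everybody
    persons↭ = concatMap-expand-↭ {ts = ts} o↭ ts↭

    seats : ∃[ v ] toList {n = #persons} v ≡ persons
    seats = toList-surjective persons (≡.trans (↭-length persons↭) length-everybody)
    v : Vec Person #persons
    v = proj₁ seats
    s : Arrangement
    s = enumeration⇒↔ v
      (subst Unique (sym (proj₂ seats)) (Unique-resp-↭ (↭-sym persons↭) everybody-unique))
      (λ p → subst (p ∈_) (sym (proj₂ seats)) (∈-resp-↭ (↭-sym persons↭) (∈-everybody p)))
    occ : Fin #persons → Person
    occ = Inverse.to s
    window-s : window occ zero #persons ≡ persons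
    window-s = ≡.trans (window-lookup v) (proj₂ seats)

    last : ∃[ q ] Chain Compatible (proj₁ (inhabitant z′)) persons q × Belongs (finalZone z z′ n) q
    last = Path.walk (cross-path b (opposite-sym opp) zero (itinerary-path b opp cs us vs)) (proj₂ (inhabitant z′))
    closed : Chain Compatible (proj₁ last) persons (proj₁ last)
    closed = reclose {z = z} {ts = itinerary z z′ cs us vs} opp zero (proj₁ (proj₂ last))
      (subst (λ z → Belongs z (proj₁ last)) final (proj₂ (proj₂ last)))
    compatible : ∀ i → Compatible (occ i) (occ (rotate 1 i))
    compatible = closed-chain occ (subst (λ l → Chain Compatible (proj₁ last) l (proj₁ last)) (sym window-s) closed)

    together : ∀ f → SitsTogether s f
    together f with token-∈ {ts} ts↭ f
    ... | t , t∈ , t≡f with ∈-∃++ t∈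
    ... | xs , ys , ts≡ = contiguous⇒together s f a λ p → subst (λ l → p ∈ l ⇔ p MemberOf f)
      (≡.trans (sym segment) (cong (window occ a) (proj₂ (spells o↭ t f t≡f)))) (proj₁ (spells o↭ t f t≡f) p)
      where
      E = concatMap (expand o)
      -- The block of `f` begins after all persons of the tokens that precede `t`.
      a = rotate (length (E xs)) zero
      segment : window occ a (length (expand o t)) ≡ expand o t
      segment = window-segment occ zero #persons (E xs) (expand o t) (E ys)
        (≡.trans window-s (≡.trans (cong E ts≡) (List.concatMap-++ (expand o) xs (t ∷ ys))))

  -- From seatings to itineraries

  -- With at least two couples at the table no family fills it, so the seat after a family's block
  -- lies outside the block.
  size<#persons : ∀ f → suc (#wives f) < #persons
  size<#persons (couple _)    = s≤s (s≤s (s≤s z≤n))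
  size<#persons (triple _)    = s≤s (s≤s (s≤s (s≤s z≤n)))
  size<#persons (quadruple i) = s≤s (≤-trans (Fin⇒≤ i 4) (≤-trans (m≤n+m (n₄ * 4) _) (≤-trans
    (≤-trans (m≤m+n _ (n₅ * 5)) (m≤m+n _ m)) (≤-trans (m≤m+n _ w) (m≤n+m _ 3)))))
  size<#persons (pentuple i)  = s≤s (≤-trans (Fin⇒≤ i 5) (≤-trans (m≤n+m (n₅ * 5) _) (≤-trans
    (≤-trans (m≤m+n _ m) (m≤m+n _ w)) (m≤n+m _ 3))))

  unmember : ∀ f ps → (∀ {p} → p ∈ ps → p MemberOf f) → ∃[ l ] ps ≡ map (member f) l
  unmember f []       _   = [] , ≡.refl
  unmember f (p ∷ ps) all with MemberOf⇒member (all (here ≡.refl)) | unmember f ps (all ∘ there)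
  ... | x , ≡.refl | l , ≡.refl = x ∷ l , ≡.refl

  couple-pair : ∀ o {p q c} → p MemberOf couple c → q MemberOf couple c → p ≢ q →
                ∃[ z ] p ∷ q ∷ [] ≡ expand o (cross z c)
  couple-pair o (husband _)   (wife _ zero) _   = women , ≡.refl
  couple-pair o (wife _ zero) (husband _)   _   = men , ≡.refl
  couple-pair o (husband _)   (husband _)   p≢q = contradiction ≡.refl p≢q
  couple-pair o (wife _ zero) (wife _ zero) p≢q = contradiction ≡.refl p≢q

  module Parse (seating : Seating) where

    open Seating seating using (arrangement; admissible) renaming (occupant to occ; seatOf to seatOf)
    open Admissible admissible using (familiesTogether)

    compatible : ∀ i → Compatible (occ i) (occ (rotate 1 i))
    compatible = admissible⇒compatible arrangement admissible

    start : Family → Fin #persons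
    start f = proj₁ (familiesTogether f)

    contiguous : ∀ f → Contiguous arrangement f (start f)
    contiguous f = together⇒contiguous arrangement f (familiesTogether f)

    position : ∀ {i f} → occ i MemberOf f → ∃[ k ] k < suc (#wives f) × i ≡ rotate k (start f)
    position {i} {f} = Equivalence.to (proj₂ (familiesTogether f) i)

    member-at : ∀ {k} f → k < suc (#wives f) → occ (rotate k (start f)) MemberOf f
    member-at f k< = Equivalence.from (proj₂ (familiesTogether f) _) (_ , k< , ≡.refl)

    position-unique : ∀ {k l f} → k ≤ suc (#wives f) → l ≤ suc (#wives f) →
                      rotate k (start f) ≡ rotate l (start f) → k ≡ l
    position-unique {f = f} k≤ l≤ = rotate-cancel {i = start f}
      (≤-trans (s≤s k≤) (size<#persons f)) (≤-trans (s≤s l≤) (size<#persons f))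

    before-start : ∀ {c f} → rotate 1 c ≡ start f → ¬ occ c MemberOf f
    before-start {c} {f} eq c∈f with position c∈f
    ... | k , k< , ≡.refl with position-unique {suc k} {0} {f} k< z≤n
                                 (≡.trans (sym (rotate-suc′ k (start f))) (≡.trans eq (sym (rotate-0 (start f)))))
    ... | ()

    after-end : ∀ f → ¬ occ (rotate (suc (#wives f)) (start f)) MemberOf f
    after-end f ∈f with position ∈f
    ... | k , k< , eq = <⇒≢ k< (sym (position-unique {suc (#wives f)} {k} {f} ≤-refl (≤-trans (n≤1+n _) k<) eq))

    -- Applied at both ends of a large family's block, where the outer neighbour is no member, it
    -- shows that the block begins and ends with a wife.
    no-polygamist : ∀ {h p q} → Compatible p q → p ≡ husband (family h) → ¬ q MemberOf family h → ⊥
    no-polygamist {h} (bothMen p _)   ≡.refl _  = polygamist-not-plain h p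
    no-polygamist     (wed wf)        ≡.refl q∉ = q∉ (wife-MemberOf wf)

    harem-order : ∀ h → ∃[ l ] window occ (start (family h)) (suc (#wives (family h))) ≡ map (member (family h)) l
                             × Bracketed (allFin (#wives (family h))) l
    harem-order h with unmember (family h) (window occ (start (family h)) (suc (#wives (family h))))
                         (λ {p} → Equivalence.to (contiguous (family h) p))
    ... | l , eq = l , eq , bracketed-by l eq (initLast l)
      where
      f = family h
      k = #wives f
      a = start f
      module _ (l : Order f) (eq : window occ a (suc k) ≡ map (member f) l) where
        l↭ : l ↭ roster f
        l↭ = enumerations-↭ (Unique.map⁻ (subst Unique eq
            (window-unique (occ-injective arrangement) a (≤-trans (n≤1+n _) (size<#persons f)))))
          (roster-unique f) complete (∈-roster f)
          where
          complete : ∀ x → x ∈ l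
          complete x with ∈-map⁻ (member f) (subst (member f x ∈_) eq
                            (Equivalence.from (contiguous f (member f x)) (member-MemberOf f x)))
          ... | y , y∈ , same rewrite member-injective f {x} {y} same = y∈

        previous : Fin #persons
        previous = rotate (#persons ∸ 1) a
        previous-next : rotate 1 previous ≡ a
        previous-next = ≡.trans (rotate-suc′ _ a) (rotate-N a)

        starts-wife : ∀ x l′ → l ≡ x ∷ l′ → ∃[ i ] x ≡ just i
        starts-wife (just i) _  _      = i , ≡.refl
        starts-wife nothing  l′ ≡.refl = ⊥-elim (no-polygamist {h}
          (compatible-sym (compatible previous))
          (≡.trans (cong occ previous-next) (List.∷-injectiveˡ eq)) (before-start previous-next))

        last-person : window occ a (suc k) ≡ window occ a k ++ [ occ (rotate k a) ]
        last-person = ≡.trans (cong (window occ a) (+-comm 1 k)) (window-+ occ a k 1)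

        ends-wife : ∀ l′ x → l ≡ l′ ∷ʳ x → ∃[ i ] x ≡ just i
        ends-wife l′ (just i) _      = i , ≡.refl
        ends-wife l′ nothing  ≡.refl = ⊥-elim (no-polygamist {h} (compatible (rotate k a))
          (List.∷ʳ-injectiveʳ (window occ a k) (map (member f) l′)
            (≡.trans (sym last-person) (≡.trans eq (List.map-++ (member f) l′ [ nothing ]))))
          (after-end f ∘ subst (λ i → occ i MemberOf f) (rotate-suc′ k a)))

        bracketed-by : List.InitLast l → Bracketed (allFin k) l
        bracketed-by il = go l il ≡.refl
          where
          go : ∀ l₀ → List.InitLast l₀ → l ≡ l₀ → Bracketed (allFin k) l
          go _ [] e with () ← ≡.trans eq (cong (map (member f)) e)
          go _ (l′ ∷ʳ′ x) e with ends-wife l′ x e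
          go _ (l′ ∷ʳ′ x) e | j , ≡.refl = front l′ e
            where
            front : ∀ l′ → l ≡ l′ ∷ʳ just j → Bracketed (allFin k) l
            front [] e = bracketed {front = []} l↭ e e
            front (y ∷ l′) e with starts-wife y _ e
            ... | i , ≡.refl = bracketed {front = just i ∷ l′} l↭ e e

    order : Orders
    order h = proj₁ (harem-order h)

    bracketing : Bracketing order
    bracketing h = proj₂ (proj₂ (harem-order h))

    couple-block : ∀ c → ∃[ z ] window occ (start (couple c)) 2 ≡ expand order (cross z c)
    couple-block c = couple-pair order (at (here ≡.refl)) (at (there (here ≡.refl))) distinct
      where
      a = start (couple c)
      at : ∀ {p} → p ∈ window occ a 2 → p MemberOf couple c
      at = Equivalence.to (contiguous (couple c) _)
      distinct : occ a ≢ occ (rotate 1 a)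
      distinct eq with position-unique {0} {1} {couple c} z≤n (s≤s z≤n)
                         (≡.trans (rotate-0 a) (occ-injective arrangement eq))
      ... | ()

    Separate : Fin #persons → Fin #persons → Set
    Separate c b = ∀ f → occ c MemberOf f → ¬ occ b MemberOf f

    -- At a positive offset within the block of `f`, the preceding seat `c` would hold a member of
    -- `f` as well.
    separate⇒start : ∀ {c b f} → b ≡ rotate 1 c → Separate c b → occ b MemberOf f → b ≡ start f
    separate⇒start {c} {b} {f} next separate ∈f with position ∈f
    ... | zero  , _  , eq = ≡.trans eq (rotate-0 (start f))
    ... | suc k , k< , eq =
      contradiction ∈f (separate f (subst (λ i → occ i MemberOf f) (sym c≡) (member-at {k} f (≤-trans (n≤1+n _) k<))))
      where
      c≡ : c ≡ rotate k (start f)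
      c≡ = rotate-injective 1 (≡.trans (sym next) (≡.trans eq (sym (rotate-suc′ k (start f)))))

    separate-after : ∀ f → Separate (rotate (#wives f) (start f)) (rotate 1 (rotate (#wives f) (start f)))
    separate-after f g ∈g next∈g with MemberOf-unique ∈g (member-at f ≤-refl)
    ... | ≡.refl = after-end f (subst (λ i → occ i MemberOf f) (rotate-suc′ (#wives f) (start f)) next∈g)

    -- Husband and wife share a family, so at a block boundary only `bothWomen` and `bothMen` are
    -- left.
    next-zone : ∀ {z c b} → b ≡ rotate 1 c → Separate c b → Belongs z (occ c) → Belongs z (occ b)
    next-zone {z} {c} ≡.refl separate = continue z (occ c) (occ (rotate 1 c)) separate (compatible c)
      where
      continue : ∀ z p q → (∀ f → p MemberOf f → ¬ q MemberOf f) → Compatible p q → Belongs z p → Belongs z q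
      continue women p q fresh (bothWomen _ q!) _ = q!
      continue men   p q fresh (bothMen _ q!)   _ = q!
      continue women p q fresh (bothMen () _) (wife _ _)
      continue women p q fresh (bothMen () _) (singleWoman _)
      continue men   p q fresh (bothWomen () _) (husband _)
      continue men   p q fresh (bothWomen () _) (singleMan _)
      continue z _ _ fresh (wed (wife f i))  _ = contradiction (wife f i) (fresh f (husband f))
      continue z _ _ fresh (wed˘ (wife f i)) _ = contradiction (husband f) (fresh f (wife f i))

    origin : Fin #persons
    origin = start (couple zero)

    -- The number of crossings is left open, since a stretch of seats does not show in advance how
    -- many couples it holds.
    record Parsed (z z′ : Zone) (b : Fin #persons) (t : ℕ) : Set where
      constructor parsed
      field
        {crossings} : ℕ
        couples : Vec Couple crossings
        us      : Vec (List (Item z)) (suc ⌊ crossings /2⌋)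
        vs      : Vec (List (Item z′)) ⌈ crossings /2⌉
        reads   : window occ b t ≡ concatMap (expand order) (itinerary z z′ couples us vs)

    parsed-item : ∀ {z z′ b t b′ t′} x → window occ b t ≡ expand order (item z x) ++ window occ b′ t′ →
                  Parsed z z′ b′ t′ → Parsed z z′ b t
    parsed-item x eq (parsed []       (u ∷ []) [] reads) = parsed [] ((x ∷ u) ∷ []) [] (≡.trans eq (cong (_ ++_) reads))
    parsed-item x eq (parsed (c ∷ cs) (u ∷ us) vs reads) =
      parsed (c ∷ cs) ((x ∷ u) ∷ us) vs (≡.trans eq (cong (_ ++_) reads))

    -- Behind the crossing the zones have exchanged their roles, hence the exchange of `us` and
    -- `vs`. The visit to `z` that ends here is recorded as empty; `parsed-item` adds its items as
    -- the recursion returns.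
    parsed-cross : ∀ {z z′ b t b′ t′} c → window occ b t ≡ expand order (cross z′ c) ++ window occ b′ t′ →
                   Parsed z′ z b′ t′ → Parsed z z′ b t
    parsed-cross c eq (parsed cs us vs reads) = parsed (c ∷ cs) ([] ∷ vs) us (≡.trans eq (cong (_ ++_) reads))

    -- Otherwise the origin would lie inside the block of `f`. Then `f` would be couple 0, and the
    -- origin would have a positive offset from the start of its own block.
    block-fits : ∀ {f b t} → b ≡ start f → rotate (suc t) b ≡ origin → suc t < #persons → suc (#wives f) ≤ suc t
    block-fits {f} {b} {t} ≡.refl end t< with suc t <? suc (#wives f)
    ... | no t≮    = ≮⇒≥ t≮
    ... | yes t<   with MemberOf-unique (member-at f t<) (subst (λ i → occ i MemberOf couple zero) (sym end)
                          (subst (λ i → occ i MemberOf couple zero) (rotate-0 origin) (member-at (couple zero) z<s)))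
    ... | ≡.refl with position-unique {suc t} {0} {couple zero} (≤-trans (n≤1+n _) t<) z≤n
                       (≡.trans end (sym (rotate-0 origin)))
    ... | ()

    split-block : ∀ {f b t} → b ≡ start f → rotate (suc t) b ≡ origin → suc t < #persons →
                  let c = rotate (#wives f) b ; t′ = t ∸ #wives f in
                  window occ b (suc t) ≡ window occ (start f) (suc (#wives f)) ++ window occ (rotate 1 c) t′
                  × rotate t′ (rotate 1 c) ≡ origin × Separate c (rotate 1 c)
    split-block {f} {b} {t} ≡.refl end t< = ≡.trans (cong (window occ b) t≡)
      (≡.trans (window-+ occ b (suc k) (t ∸ k))
        (cong (λ c → window occ b (suc k) ++ window occ c (t ∸ k)) (sym (rotate-suc′ k b)))) ,
      ≡.trans (cong (rotate (t ∸ k)) (rotate-suc′ k b))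
        (≡.trans (rotate-+ (suc k) (t ∸ k) b) (≡.trans (cong (λ j → rotate j b) (sym t≡)) end)) ,
      separate-after f
      where
      k = #wives f
      t≡ : suc t ≡ suc k + (t ∸ k)
      t≡ = cong suc (sym (m+[n∸m]≡n (≤-pred (block-fits ≡.refl end t<))))

    harem-last : ∀ h → Woman (occ (rotate (#wives (family h)) (start (family h))))
    harem-last h = subst Woman (sym (List.∷ʳ-injectiveʳ (window occ a k) (map (member f) (Bracketed.front br))
        (≡.trans (sym (≡.trans (cong (window occ a) (+-comm 1 k)) (window-+ occ a k 1)))
        (≡.trans (proj₁ (proj₂ (harem-order h)))
        (≡.trans (cong (map (member f)) (Bracketed.ends br)) (List.map-++ (member f) (Bracketed.front br) _))))))
      (wife f (Bracketed.last br))
      where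
      f = family h
      k = #wives f
      a = start f
      br = bracketing h

    couple-start : ∀ {x b} z → b ≡ start (couple x) → window occ (start (couple x)) 2 ≡ expand order (cross z x) →
                   Belongs (other z) (occ b) × Belongs z (occ (rotate (#wives (couple x)) b))
    couple-start {x} women ≡.refl block =
      subst PlainMan (sym (List.∷-injectiveˡ block)) (husband x) ,
      subst Woman (sym (List.∷-injectiveˡ (List.∷-injectiveʳ block))) (wife _ zero)
    couple-start {x} men ≡.refl block =
      subst Woman (sym (List.∷-injectiveˡ block)) (wife _ zero) ,
      subst PlainMan (sym (List.∷-injectiveˡ (List.∷-injectiveʳ block))) (husband x)

    one-zone : ∀ {p} → Woman p → PlainMan p → ⊥
    one-zone (wife _ _)      ()
    one-zone (singleWoman _) ()

    -- The invariant: t seats remain from `b` up to the origin, the seat `c` before `b` holds a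
    -- person of zone `z`, and a block ends between them. A family consumes several seats at once,
    -- so the recursion on t is not structural and runs on fuel.
    parse : ∀ fuel {z z′ c b t} → Opposite z z′ → b ≡ rotate 1 c → t ≤ fuel → rotate t b ≡ origin → t < #persons →
            Belongs z (occ c) → Separate c b → Parsed z z′ b t
    parse fuel       {t = zero}  opp _    _         _   _  _       _     = parsed [] ([] ∷ []) [] ≡.refl
    parse (suc fuel) {b = b} {t = suc t} opp next (s≤s t≤) end t< belongs separate =
      step opp (next-zone next separate belongs) ≡.refl
      where
      end-single : rotate t (rotate 1 b) ≡ origin
      end-single = ≡.trans (rotate-suc t b) end

      couple-step : ∀ {z z′} → Opposite z z′ → ∀ x → Belongs z (occ b) → occ b MemberOf couple x → Parsed z z′ b (suc t)
      couple-step {z} {z′} opp x belongs b∈x =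
        orient opp (proj₁ (couple-block x)) (proj₂ (couple-block x)) belongs
          (proj₁ start-zones) (proj₂ start-zones)
        where
        k = #wives (couple x)
        b≡ : b ≡ start (couple x)
        b≡ = separate⇒start next separate b∈x
        start-zones : Belongs (other (proj₁ (couple-block x))) (occ b) ×
                      Belongs (proj₁ (couple-block x)) (occ (rotate k b))
        start-zones = couple-start (proj₁ (couple-block x)) b≡ (proj₂ (couple-block x))
        block = split-block {couple x} {b} {t} b≡ end t<
        resume : ∀ {z z′} → Opposite z z′ → window occ (start (couple x)) 2 ≡ expand order (cross z′ x) →
                 Belongs z′ (occ (rotate k b)) → Parsed z z′ b (suc t)
        resume opp reads spouse =
          parsed-cross {b = b} {t = suc t} {b′ = rotate 1 (rotate k b)} {t′ = t ∸ k} x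
            (≡.trans (proj₁ block) (cong (_++ window occ (rotate 1 (rotate k b)) (t ∸ k)) reads))
            (parse fuel {c = rotate k b} {t = t ∸ k} (opposite-sym opp) ≡.refl (≤-trans (m∸n≤m t k) t≤)
              (proj₁ (proj₂ block)) (≤-trans (s≤s (m≤n⇒m≤1+n (m∸n≤m t k))) t<) spouse (proj₂ (proj₂ block)))
        orient : ∀ {z z′} → Opposite z z′ → ∀ z₀ → window occ (start (couple x)) 2 ≡ expand order (cross z₀ x) →
                 Belongs z (occ b) → Belongs (other z₀) (occ b) → Belongs z₀ (occ (rotate k b)) → Parsed z z′ b (suc t)
        -- The spouse met first belongs to the current zone, so the couple can only be oriented
        -- towards the other zone.
        orient women-men women _     b! b!′ _      = ⊥-elim (one-zone b! b!′)
        orient men-women men   _     b! b!′ _      = ⊥-elim (one-zone b!′ b!)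
        orient women-men men   reads _  _   spouse = resume women-men reads spouse
        orient men-women women reads _  _   spouse = resume men-women reads spouse

      harem-step : ∀ h → occ b MemberOf family h → Parsed women men b (suc t)
      harem-step h b∈h with separate⇒start next separate b∈h
      ... | b≡ with split-block {family h} {b} {t} b≡ end t<
      ... | split , end′ , separate′ =
        parsed-item {b = b} {t = suc t} {b′ = rotate 1 (rotate k b)} {t′ = t ∸ k} (inj₁ h)
          (≡.trans split (cong (_++ window occ (rotate 1 (rotate k b)) (t ∸ k)) (proj₁ (proj₂ (harem-order h)))))
          (parse fuel {c = rotate k b} {t = t ∸ k} women-men ≡.refl (≤-trans (m∸n≤m t k) t≤) end′
            (≤-trans (s≤s (m≤n⇒m≤1+n (m∸n≤m t k))) t<)
            (subst (λ i → Woman (occ (rotate k i))) (sym b≡) (harem-last h)) separate′)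
        where k = #wives (family h)

      step : ∀ {p z z′} → Opposite z z′ → Belongs z p → occ b ≡ p → Parsed z z′ b (suc t)
      step women-men (wife f@(couple x) i) eq =
        couple-step women-men x (subst Woman (sym eq) (wife f i)) (subst (_MemberOf f) (sym eq) (wife f i))
      step women-men (wife f@(triple x) i)    eq = harem-step (triple x) (subst (_MemberOf f) (sym eq) (wife f i))
      step women-men (wife f@(quadruple x) i) eq = harem-step (quadruple x) (subst (_MemberOf f) (sym eq) (wife f i))
      step women-men (wife f@(pentuple x) i)  eq = harem-step (pentuple x) (subst (_MemberOf f) (sym eq) (wife f i))
      step women-men (singleWoman j) eq =
        parsed-item {b = b} {t = suc t} {b′ = rotate 1 b} {t′ = t} (inj₂ j) (cong (_∷ window occ (rotate 1 b) t) eq)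
          (parse fuel {c = b} {t = t} women-men ≡.refl t≤ end-single (≤-trans (n≤1+n _) t<)
            (subst Woman (sym eq) (singleWoman j))
            (λ f ∈f → contradiction (subst (_MemberOf f) eq ∈f) λ ()))
      step men-women (husband x) eq =
        couple-step men-women x (subst PlainMan (sym eq) (husband x))
          (subst (_MemberOf couple x) (sym eq) (husband (couple x)))
      step men-women (singleMan i) eq =
        parsed-item {b = b} {t = suc t} {b′ = rotate 1 b} {t′ = t} i (cong (_∷ window occ (rotate 1 b) t) eq)
          (parse fuel {c = b} {t = t} men-women ≡.refl t≤ end-single (≤-trans (n≤1+n _) t<)
            (subst PlainMan (sym eq) (singleMan i))
            (λ f ∈f → contradiction (subst (_MemberOf f) eq ∈f) λ ()))

  -- Plans, their codes and their seatings

  others : List Couple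
  others = List.tabulate suc

  -- Equals 2r, but is spelled so that `suc k₀` is by computation `length others + 0`, the length
  -- delivered by `ordering-coding`.
  k₀ : ℕ
  k₀ = length (List.tabulate {A = Couple} {n = r * 2} (λ i → suc (suc i))) + 0

  -- The orders are kept as vectors, not as a function of type `Orders`, so that tables with equal
  -- entries are equal without function extensionality.
  Table : Set
  Table = Vec (List (Maybe (Fin 2))) n₃ × Vec (List (Maybe (Fin 3))) n₄ × Vec (List (Maybe (Fin 4))) n₅

  orders : Table → Orders
  orders (t , q , p) (triple i)    = lookup t i
  orders (t , q , p) (quadruple i) = lookup q i
  orders (t , q , p) (pentuple i)  = lookup p i

  Plan : Zone → Set
  Plan z = Vec Couple (suc k₀) × Vec (List (Item z)) (suc ⌊ suc k₀ /2⌋) ×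
           Vec (List (Item (other z))) ⌈ suc k₀ /2⌉ × Table

  Valid : ∀ z → Plan z → Set
  Valid z (cs , us , vs , t , q , p) =
    toList cs ↭ others × concat (toList us) ↭ items z × concat (toList vs) ↭ items (other z) ×
    (∀ i → Bracketed (allFin 2) (lookup t i)) ×
    (∀ i → Bracketed (allFin 3) (lookup q i)) ×
    (∀ i → Bracketed (allFin 4) (lookup p i))

  -- OrderCode k codes the orders of a family with k + 1 wives.
  OrderCode : ℕ → Set
  OrderCode k = Fin k × ShuffleCode (suc k) 0

  PlanCode : Zone → Set
  PlanCode z =
    ShuffleCode (length others) 0 ×
    ShuffleCode (length (map just (items z))) ⌊ suc k₀ /2⌋ ×
    ShuffleCode (length (map just (items (other z)))) ⌊ k₀ /2⌋ ×
    Vec (OrderCode 1) n₃ × Vec (OrderCode 2) n₄ × Vec (OrderCode 3) n₅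

  plan-coding : ∀ z → Coding (PlanCode z) (Valid z)
  plan-coding z =
    ×-coding (ordering-coding (Unique.tabulate⁺ {A = Couple} {f = suc} (λ { ≡.refl → ≡.refl })))
    (×-coding (distribution-coding (items-unique z) ⌊ suc k₀ /2⌋)
    (×-coding (distribution-coding (items-unique (other z)) ⌊ k₀ /2⌋)
    (×-coding (Vec-coding (bracketed-coding (Unique.allFin⁺ 2)))
    (×-coding (Vec-coding (bracketed-coding (Unique.allFin⁺ 3)))
              (Vec-coding (bracketed-coding (Unique.allFin⁺ 4)))))))

  tokens : ∀ z → Plan z → List Token
  tokens z (cs , us , vs , _) = circuit z (other z) zero cs us vs

  table : ∀ {z} → Plan z → Table
  table (_ , _ , _ , t) = t

  persons : ∀ z → Plan z → List Person
  persons z p = concatMap (expand (orders (table {z} p))) (tokens z p)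

  valid⇒bracketing : ∀ z p → Valid z p → Bracketing (orders (table {z} p))
  valid⇒bracketing z p (_ , _ , _ , vt , vq , vp) (triple i)    = vt i
  valid⇒bracketing z p (_ , _ , _ , vt , vq , vp) (quadruple i) = vq i
  valid⇒bracketing z p (_ , _ , _ , vt , vq , vp) (pentuple i)  = vp i

  valid⇒tokens : ∀ z p → Valid z p → map unoriented (tokens z p) ↭ allTokens
  valid⇒tokens z (cs , us , vs , _) (cs↭ , us↭ , vs↭ , _) = begin
    cross women zero ∷ map unoriented (itinerary z (other z) cs us vs)
      ↭⟨ prep (cross women zero) (unoriented-itinerary z (other z) cs us vs) ⟩
    inventory z (other z) (zero ∷ toList cs) (concat (toList us)) (concat (toList vs))
      ↭⟨ inventory-↭ z (other z) (prep zero cs↭) us↭ vs↭ ⟩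
    inventory z (other z) (allFin (suc r * 2)) (items z) (items (other z))
      ↭⟨ allTokens-↭ (opposite-other z) ⟨
    allTokens ∎
    where open PermutationReasoning

  k₀≡ : k₀ ≡ r * 2
  k₀≡ = ≡.trans (+-identityʳ _) (List.length-tabulate {A = Couple} {n = r * 2} (λ i → suc (suc i)))

  abstract
    seat∃ : ∀ z p → Valid z p → ∃[ s ] window (Seating.occupant s) zero #persons ≡ persons z p
    seat∃ z p@(cs , us , vs , _) v = realise (valid⇒bracketing z p v) (opposite-other z) cs us vs
      -- One crossing leads from `z` to `other z`, and the remaining 2r crossings lead back there.
      -- This is where the evenness of n₂ closes the circle.
      (≡.trans (cong (finalZone (other z) z) k₀≡) (finalZone-even (other z) z r)) (valid⇒tokens z p v)

  seat : ∃ PlanCode → Seating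
  seat (z , c) = proj₁ (seat∃ z (Coding.decode (plan-coding z) c) (Coding.sound (plan-coding z) c))

  seat-window : ∀ ((z , c) : ∃ PlanCode) →
    window (Seating.occupant (seat (z , c))) zero #persons ≡ persons z (Coding.decode (plan-coding z) c)
  seat-window (z , c) = proj₂ (seat∃ z (Coding.decode (plan-coding z) c) (Coding.sound (plan-coding z) c))

  -- The token list can be read off, and its first entry reveals the zone that follows couple 0.
  -- Every large family occurs among the tokens, so its order is visible too.
  persons-injective : ∀ z p z′ p′ → Valid z p → Valid z′ p′ → persons z p ≡ persons z′ p′ →
                      _≡_ {A = ∃ Plan} (z , p) (z′ , p′)
  persons-injective z p@(cs , us , vs , tb) z′ p′@(cs′ , us′ , vs′ , tb′) v v′ eq
    with concatMap-expand-injective (valid⇒bracketing z p v) (valid⇒bracketing z′ p′ v′)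
           (tokens z p) (tokens z′ p′) eq
  ... | ts≡ , orders≡ with List.∷-injective ts≡
  ... | ≡.refl , its≡ with itinerary-injective z (other z) cs cs′ its≡
  ... | ≡.refl , ≡.refl , ≡.refl = cong (λ tb → z , cs , us , vs , tb) (tables tb tb′ same-order)
    where
    same-order : ∀ h → orders tb h ≡ orders tb′ h
    same-order h with token-∈ {tokens z p} (valid⇒tokens z p v) (family h)
    ... | t , t∈ , t≡ with unoriented⁻-item t (≡.trans t≡ (token-family h))
    ... | ≡.refl = List.map-injective (member-injective (family h)) (orders≡ t∈)
    tables : ∀ tb tb′ → (∀ h → orders tb h ≡ orders tb′ h) → tb ≡ tb′
    tables (t , q , p) (t′ , q′ , p′) same = cong₂ _,_ (lookup-ext t t′ (same ∘ triple))
      (cong₂ _,_ (lookup-ext q q′ (same ∘ quadruple)) (lookup-ext p p′ (same ∘ pentuple)))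

  starts-with-couple : ∀ (occ : Fin #persons → Person) z p →
    window occ zero #persons ≡ persons z p →
    occ zero MemberOf couple zero × occ (rotate 1 zero) MemberOf couple zero
  starts-with-couple occ women p eq =
    subst (_MemberOf _) (sym (List.∷-injectiveˡ eq)) (husband _) ,
    subst (_MemberOf _) (sym (List.∷-injectiveˡ (List.∷-injectiveʳ eq))) (wife _ zero)
  starts-with-couple occ men p eq =
    subst (_MemberOf _) (sym (List.∷-injectiveˡ eq)) (wife _ zero) ,
    subst (_MemberOf _) (sym (List.∷-injectiveˡ (List.∷-injectiveʳ eq))) (husband _)

  couple-has-two : ∀ {c p q x} → p MemberOf couple c → q MemberOf couple c → x MemberOf couple c →
                   p ≢ q → x ≡ p ⊎ x ≡ q
  couple-has-two (husband _)   _             (husband _)   _   = inj₁ ≡.refl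
  couple-has-two (wife _ zero) _             (wife _ zero) _   = inj₁ ≡.refl
  couple-has-two _             (husband _)   (husband _)   _   = inj₂ ≡.refl
  couple-has-two _             (wife _ zero) (wife _ zero) _   = inj₂ ≡.refl
  couple-has-two (husband _)   (husband _)   (wife _ zero) p≢q = contradiction ≡.refl p≢q
  couple-has-two (wife _ zero) (wife _ zero) (husband _)   p≢q = contradiction ≡.refl p≢q

  -- Couple 0 occupies the seats a and a + 1 both before and after the rotation.
  same-origin : ∀ (s : Arrangement) k a →
    Inverse.to s a MemberOf couple zero → Inverse.to s (rotate 1 a) MemberOf couple zero →
    Inverse.to s (rotate k a) MemberOf couple zero → Inverse.to s (rotate k (rotate 1 a)) MemberOf couple zero →
    rotate k a ≡ a
  same-origin s k a a∈ b∈ ka∈ kb∈ =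
    [ occ-injective s , (λ ka≡b → [ at-a ka≡b , at-b ka≡b ]′ (couple-has-two a∈ b∈ kb∈ a≢b)) ]′
      (couple-has-two a∈ b∈ ka∈ a≢b)
    where
    occ : Fin #persons → Person
    occ = Inverse.to s
    a≢b : occ a ≢ occ (rotate 1 a)
    a≢b eq with rotate-cancel {k = 0} {l = 1} {i = a} z<s (s<s z<s) (≡.trans (rotate-0 a) (occ-injective s eq))
    ... | ()
    two : occ (rotate k a) ≡ occ (rotate 1 a) → rotate k (rotate 1 a) ≡ rotate 2 a
    two eq = ≡.trans (rotate-suc k a) (≡.trans (sym (rotate-suc′ k a))
      (≡.trans (cong (rotate 1) (occ-injective s eq)) (rotate-suc 1 a)))
    at-a : occ (rotate k a) ≡ occ (rotate 1 a) → occ (rotate k (rotate 1 a)) ≡ occ a → rotate k a ≡ a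
    at-a ka≡b kb≡a with rotate-cancel {k = 2} {0} {a} (s<s (s<s z<s)) z<s
                          (≡.trans (sym (two ka≡b)) (≡.trans (occ-injective s kb≡a) (sym (rotate-0 a))))
    ... | ()
    at-b : occ (rotate k a) ≡ occ (rotate 1 a) → occ (rotate k (rotate 1 a)) ≡ occ (rotate 1 a) → rotate k a ≡ a
    at-b ka≡b kb≡b with rotate-cancel {k = 2} {1} {a} (s<s (s<s z<s)) (s<s z<s)
                          (≡.trans (sym (two ka≡b)) (occ-injective s kb≡b))
    ... | ()

  -- Both seatings have couple 0 on the seats 0 and 1, so by `same-origin` the rotation between them
  -- fixes seat 0. The two lists of persons read from there then agree.
  seat-injective : ∀ {c d} → seat c ≈ᵣ seat d → c ≡ d
  seat-injective {z , c} {z′ , d} (k , eq) = codes (persons-injective z (K.decode c) z′ (K′.decode d)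
      (K.sound c) (K′.sound d) (begin
    persons z (K.decode c)                   ≡⟨ seat-window (z , c) ⟨
    window occ zero #persons                 ≡⟨ cong (λ a → window occ a #persons) origin ⟨
    window occ (rotate k zero) #persons      ≡⟨ window-cong occ occ′ k eq zero #persons ⟨
    window occ′ zero #persons                ≡⟨ seat-window (z′ , d) ⟩
    persons z′ (K′.decode d)                 ∎)) ≡.refl ≡.refl
    where
    open ≡.≡-Reasoning
    module K  = Coding (plan-coding z)
    module K′ = Coding (plan-coding z′)
    occ occ′ : Fin #persons → Person
    occ  = Seating.occupant (seat (z , c))
    occ′ = Seating.occupant (seat (z′ , d))
    first : occ zero MemberOf couple zero × occ (rotate 1 zero) MemberOf couple zero
    first = starts-with-couple occ z (K.decode c) (seat-window (z , c))
    first′ : occ′ zero MemberOf couple zero × occ′ (rotate 1 zero) MemberOf couple zero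
    first′ = starts-with-couple occ′ z′ (K′.decode d) (seat-window (z′ , d))
    origin : rotate k zero ≡ zero
    origin = same-origin (Seating.arrangement (seat (z , c))) k zero (proj₁ first) (proj₂ first)
      (subst (_MemberOf couple zero) (eq zero) (proj₁ first′))
      (subst (_MemberOf couple zero) (eq (rotate 1 zero)) (proj₂ first′))
    codes : ∀ {z z′ p p′} {c : PlanCode z} {d : PlanCode z′} → _≡_ {A = ∃ Plan} (z , p) (z′ , p′) →
            Coding.decode (plan-coding z) c ≡ p → Coding.decode (plan-coding z′) d ≡ p′ →
            _≡_ {A = ∃ PlanCode} (z , c) (z′ , d)
    codes {z} ≡.refl c≡ d≡ = cong (z ,_) (Coding.injective (plan-coding z) (≡.trans c≡ (sym d≡)))

  -- Every seating comes from a plan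

  record Planned (s : Seating) : Set where
    field
      origin : Fin #persons
      zone   : Zone
      plan  : Plan zone
      valid  : Valid zone plan
      reads  : window (Seating.occupant s) origin #persons ≡ persons zone plan

  module Reading (s : Seating) where
    open Parse s

    tabled : Table
    tabled = Vec.tabulate (order ∘ triple) , Vec.tabulate (order ∘ quadruple) , Vec.tabulate (order ∘ pentuple)

    orders-tabled : ∀ h → orders tabled h ≡ order h
    orders-tabled (triple i)    = Vec.lookup∘tabulate (order ∘ triple) i
    orders-tabled (quadruple i) = Vec.lookup∘tabulate (order ∘ quadruple) i
    orders-tabled (pentuple i)  = Vec.lookup∘tabulate (order ∘ pentuple) i

    expand-tabled : ∀ t → expand order t ≡ expand (orders tabled) t
    expand-tabled (cross women c)       = ≡.refl
    expand-tabled (cross men c)         = ≡.refl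
    expand-tabled (item women (inj₁ h)) = cong (map (member (family h))) (sym (orders-tabled h))
    expand-tabled (item women (inj₂ j)) = ≡.refl
    expand-tabled (item men i)          = ≡.refl

    tabled-bracketing : Bracketing (orders tabled)
    tabled-bracketing h = subst (Bracketed _) (sym (orders-tabled h)) (bracketing h)

    occ : Fin #persons → Person
    occ = Seating.occupant s

    planned-by : ∀ z → window occ origin 2 ≡ expand order (cross z zero) →
                 Parsed z (other z) (rotate 1 (rotate 1 origin)) (#persons ∸ 2) → Planned s
    planned-by z block (parsed cs us vs reads) = plan-of cs us vs crossings≡ reads-all tokens↭
      where
      ts : List Token
      ts = circuit z (other z) zero cs us vs
      reads-all : window occ origin #persons ≡ concatMap (expand (orders tabled)) ts
      reads-all = ≡.trans (cong₂ _++_ block reads) (List.concatMap-cong expand-tabled ts)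
      window↭ : window occ origin #persons ↭ everybody
      window↭ = enumerations-↭ (window-unique (occ-injective (Seating.arrangement s)) origin ≤-refl) everybody-unique
        present ∈-everybody
        where
        present : ∀ p → p ∈ window occ origin #persons
        present p = subst (_∈ window occ origin #persons) (Inverse.strictlyInverseˡ (Seating.arrangement s) p)
          (∈-full-window occ origin (Seating.seatOf s p))
      tokens↭ : zero ∷ toList cs ↭ allFin (suc r * 2) ×
                concat (toList us) ↭ items z × concat (toList vs) ↭ items (other z)
      tokens↭ = inventory-↭⁻ (opposite-other z) (↭-trans
        (prep (cross women zero) (↭-sym (unoriented-itinerary z (other z) cs us vs)))
        (tokens-↭ {ts = ts} (bracketing⇒permuted tabled-bracketing) (↭-trans (↭-reflexive (sym reads-all)) window↭)))
      -- Everybody occurs once in the full window, which determines the number of couples that the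
      -- parse had left open.
      crossings≡ : _ ≡ suc k₀
      crossings≡ = ≡.trans (sym (Vec.length-toList cs))
        (≡.trans (↭-length (drop-∷ (proj₁ tokens↭))) (sym (+-identityʳ (length others))))
      plan-of : ∀ {n} (cs : Vec Couple n) us vs → n ≡ suc k₀ →
        window occ origin #persons ≡ concatMap (expand (orders tabled)) (circuit z (other z) zero cs us vs) →
        zero ∷ toList cs ↭ allFin (suc r * 2) × concat (toList us) ↭ items z × concat (toList vs) ↭ items (other z) →
        Planned s
      plan-of cs us vs ≡.refl reads (cs↭ , us↭ , vs↭) = record
        { origin = origin
        ; zone   = z
        ; plan  = cs , us , vs , tabled
        ; valid  = drop-∷ cs↭ , us↭ , vs↭ ,
                   tabled-bracketing ∘ triple , tabled-bracketing ∘ quadruple , tabled-bracketing ∘ pentuple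
        ; reads  = reads
        }

    planned : Planned s
    planned = planned-by z block (parse (#persons ∸ 2)
      {c = rotate 1 origin} {b = rotate 1 (rotate 1 origin)} {t = #persons ∸ 2}
      (opposite-other z) ≡.refl ≤-refl (rotate-back origin (s≤s (s≤s z≤n))) (m≤n⇒m≤1+n ≤-refl) zone-entered separate)
      where
      z : Zone
      z = proj₁ (couple-block zero)
      block : window occ origin 2 ≡ expand order (cross z zero)
      block = proj₂ (couple-block zero)
      zone-entered : Belongs z (occ (rotate 1 origin))
      zone-entered = proj₂ (couple-start {zero} {origin} z ≡.refl block)
      separate : Separate (rotate 1 origin) (rotate 1 (rotate 1 origin))
      separate = separate-after (couple zero)

  planned⇒seat : ∀ {s} → Planned s → ∃[ c ] s ≈ᵣ seat c
  planned⇒seat {s} planned = (zone , proj₁ coded) , proj₁ reach , same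
    where
    open Planned planned
    coded : ∃[ c ] Coding.decode (plan-coding zone) c ≡ plan
    coded = Coding.complete (plan-coding zone) plan valid
    occ occ′ : Fin #persons → Person
    occ  = Seating.occupant s
    occ′ = Seating.occupant (seat (zone , proj₁ coded))
    windows : window occ origin #persons ≡ window occ′ zero #persons
    windows = ≡.trans reads (≡.trans (cong (persons zone) (sym (proj₂ coded))) (sym (seat-window (zone , proj₁ coded))))
    reach : ∃[ k ] k < #persons × origin ≡ rotate k zero
    reach = rotate-reaches {#persons} zero origin
    same : ∀ i → occ′ i ≡ occ (rotate (proj₁ reach) i)
    same = equal-windows⇒rotated occ occ′ {origin} {zero} (proj₁ reach) (proj₂ (proj₂ reach)) windows

  seat-surjective : ∀ s → ∃[ c ] s ≈ᵣ seat c
  seat-surjective s = planned⇒seat (Reading.planned s)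

  -- The number of plans and the closed formula

  #orders : ℕ → ℕ
  #orders k = k * rising (suc k) 0

  #plans : Zone → ℕ
  #plans z =
    rising (length others) 0 *
    (rising (length (map just (items z))) ⌊ suc k₀ /2⌋ *
    (rising (length (map just (items (other z)))) ⌊ k₀ /2⌋ *
    (#orders 1 ^ n₃ * (#orders 2 ^ n₄ * #orders 3 ^ n₅))))

  Fin↔OrderCode : ∀ k → Fin (#orders k) ↔ OrderCode k
  Fin↔OrderCode k = ↔-trans *↔× (↔-refl ×-↔ Fin↔ShuffleCode (suc k) 0)

  Fin↔PlanCode : ∀ z → Fin (#plans z) ↔ PlanCode z
  Fin↔PlanCode z =
    ↔-trans *↔× (Fin↔ShuffleCode _ 0 ×-↔
    ↔-trans *↔× (Fin↔ShuffleCode _ ⌊ suc k₀ /2⌋ ×-↔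
    ↔-trans *↔× (Fin↔ShuffleCode _ ⌊ k₀ /2⌋ ×-↔
    ↔-trans *↔× (Fin^↔Vec (Fin↔OrderCode 1) n₃ ×-↔
    ↔-trans *↔× (Fin^↔Vec (Fin↔OrderCode 2) n₄ ×-↔ Fin^↔Vec (Fin↔OrderCode 3) n₅)))))

  Fin↔codes : Fin (#plans women + #plans men) ↔ ∃ PlanCode
  Fin↔codes = ↔-trans +↔⊎ (↔-trans (Fin↔PlanCode women ⊎-↔ Fin↔PlanCode men)
    (mk↔ₛ′ to from (λ { (women , _) → ≡.refl ; (men , _) → ≡.refl }) (λ { (inj₁ _) → ≡.refl ; (inj₂ _) → ≡.refl })))
    where
    to : PlanCode women ⊎ PlanCode men → ∃ PlanCode
    to (inj₁ c) = women , c
    to (inj₂ c) = men , c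
    from : ∃ PlanCode → PlanCode women ⊎ PlanCode men
    from (women , c) = inj₁ c
    from (men , c)   = inj₂ c

  seatings-count : HasCardinality SeatingsUpToRotation (#plans women + #plans men)
  seatings-count = enumeration⇒HasCardinality SeatingsUpToRotation Fin↔codes seat
    (λ {c} {d} → seat-injective {c} {d}) seat-surjective

  length-others : length others ≡ suc (r * 2)
  length-others = List.length-tabulate {A = Couple} suc

  ⌊2r/2⌋ : ∀ r → ⌊ r * 2 /2⌋ ≡ r
  ⌊2r/2⌋ zero    = ≡.refl
  ⌊2r/2⌋ (suc r) = cong suc (⌊2r/2⌋ r)

  ⌊1+2r/2⌋ : ∀ r → ⌊ suc (r * 2) /2⌋ ≡ r
  ⌊1+2r/2⌋ zero    = ≡.refl
  ⌊1+2r/2⌋ (suc r) = cong suc (⌊1+2r/2⌋ r)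

  #items : Zone → ℕ
  #items women = n₃ + n₄ + n₅ + w
  #items men   = m

  length-items : ∀ z → length (items z) ≡ #items z
  length-items men   = List.length-tabulate {n = m} id
  length-items women = ≡.trans (List.length-++ (map inj₁ harems)) (cong₂ _+_
    (≡.trans (List.length-map inj₁ harems) (≡.trans (List.length-++ (map triple (allFin n₃)))
      (≡.trans (cong₂ _+_ (over {n₃} {Harem} triple) (≡.trans (List.length-++ (map quadruple (allFin n₄)))
        (cong₂ _+_ (over {n₄} {Harem} quadruple) (over {n₅} {Harem} pentuple)))) (sym (+-assoc n₃ n₄ n₅)))))
    (over {w} {Item women} inj₂))
    where
    over : ∀ {k} {A : Set} (g : Fin k → A) → length (map g (allFin k)) ≡ k
    over {k} g = ≡.trans (List.length-map g (allFin k)) (List.length-tabulate {n = k} id)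

  #tables : ℕ
  #tables = (1 * 2 !) ^ n₃ * ((2 * 3 !) ^ n₄ * (3 * 4 !) ^ n₅)

  #plans≡ : ∀ z → #plans z ≡ suc (r * 2) ! * (rising (#items z) r * (rising (#items (other z)) r * #tables))
  #plans≡ z = cong₂ _*_ (≡.trans (cong (λ k → rising k 0) length-others) (rising-0 (suc (r * 2))))
    (cong₂ _*_ (cong₂ rising (length-letters z) (≡.trans (cong (λ k → ⌊ suc k /2⌋) k₀≡) (⌊1+2r/2⌋ r)))
    (cong (_* #tables) (cong₂ rising (length-letters (other z)) (≡.trans (cong ⌊_/2⌋ k₀≡) (⌊2r/2⌋ r)))))
    where
    length-letters : ∀ z → length (map just (items z)) ≡ #items z
    length-letters z = ≡.trans (List.length-map just (items z)) (length-items z)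

  -- Splitting r + 1 off both (2r + 2)! and (r + 1)! leaves 2 (2r + 1)! divided by r!, and this
  -- division is exact because r ≤ 2r + 1.
  couples-quotient : (((suc r * 2) !) / (suc r) !) {{ suc r !≢0 }} * r ! ≡ 2 * suc (r * 2) !
  couples-quotient = begin
    ((suc r * 2) ! / (suc r) !) * r !     ≡⟨ cong (_* r !) (/-congˡ {o = (suc r) !} (*-assoc (suc r) 2 (suc (r * 2) !))) ⟩
    ((suc r * D) / (suc r * r !)) * r !   ≡⟨ cong (_* r !) (m*n/m*o≡n/o (suc r) D (r !)) ⟩
    (D / r !) * r !                       ≡⟨ m/n*n≡m (∣n⇒∣m*n 2 (m≤n⇒m!∣n! (m≤n⇒m≤1+n (m≤m*n r 2)))) ⟩
    D                                     ∎
    where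
    open ≡.≡-Reasoning
    D : ℕ
    D = 2 * suc (r * 2) !
    instance
      _ = r !≢0
      _ = suc r !≢0

  men-quotient : ((r + m) ! / r !) {{ r !≢0 }} ≡ rising m r
  men-quotient = ≡.trans (/-congˡ {o = r !} (≡.trans (cong _! (+-comm r m)) (sym (rising-! m r))))
    (m*n/n≡m (rising m r) (r !))
    where
    instance
      _ = r !≢0

  -- `h` stands for n₂ / 2, which equals `suc r` only propositionally and also occurs in the nonzero
  -- proofs of the divisions; matching on the equation replaces it everywhere at once.
  formula : ∀ h → h ≡ suc r → #plans women + #plans men ≡
    (1 * 2 !) ^ n₃ * (2 * 3 !) ^ n₄ * (3 * 4 !) ^ n₅
    * ((suc r * 2) ! / h !) {{ h !≢0 }}
    * ((h + m ∸ 1) ! / (h ∸ 1) !) {{ (h ∸ 1) !≢0 }}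
    * (h + n₃ + n₄ + n₅ + w ∸ 1) !
  formula _ ≡.refl = begin
    #plans women + #plans men
      ≡⟨ cong₂ _+_ (#plans≡ women) (#plans≡ men) ⟩
    D * (rising F r * (rising m r * #tables)) + D * (rising m r * (rising F r * #tables))
      -- The two orientations of couple 0 admit equally many plans, whence the factor 2.
      ≡⟨ gather D (rising F r) (rising m r) A₃ A₄ A₅ ⟩
    A₃ * A₄ * A₅ * (2 * D) * rising m r * rising F r
      ≡⟨ cong (λ x → A₃ * A₄ * A₅ * x * rising m r * rising F r) couples-quotient ⟨
    A₃ * A₄ * A₅ * (Q * r !) * rising m r * rising F r
      ≡⟨ distribute A₃ A₄ A₅ Q (r !) (rising m r) (rising F r) ⟩
    A₃ * A₄ * A₅ * Q * rising m r * (rising F r * r !)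
      ≡⟨ cong₂ (λ x y → A₃ * A₄ * A₅ * Q * x * y) (sym men-quotient)
               (≡.trans (rising-! F r) (cong _! (total n₃ n₄ n₅ w r))) ⟩
    A₃ * A₄ * A₅ * Q * ((r + m) ! / r !) {{ r !≢0 }} * (r + n₃ + n₄ + n₅ + w) !
      ∎
    where
    open ≡.≡-Reasoning
    A₃ A₄ A₅ D F Q : ℕ
    F  = n₃ + n₄ + n₅ + w
    A₃ = (1 * 2 !) ^ n₃
    A₄ = (2 * 3 !) ^ n₄
    A₅ = (3 * 4 !) ^ n₅
    D  = suc (r * 2) !
    Q  = ((suc r * 2) ! / (suc r) !) {{ suc r !≢0 }}
    gather : ∀ d f m a b c → d * (f * (m * (a * (b * c)))) + d * (m * (f * (a * (b * c)))) ≡ a * b * c * (2 * d) * m * f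
    gather = solve-∀
    distribute : ∀ a b c q s m f → a * b * c * (q * s) * m * f ≡ a * b * c * q * m * (f * s)
    distribute = solve-∀
    total : ∀ a b c d r → a + b + c + d + r ≡ r + a + b + c + d
    total = solve-∀

theorem1p1 : ∀ (n₂ n₃ n₄ n₅ m w : ℕ) → 2 ∣ n₂ → 2 ≤ n₂ →
    HasCardinality (Table.SeatingsUpToRotation n₂ n₃ n₄ n₅ m w)
    ( (1 * 2 !) ^ n₃ * (2 * 3 !) ^ n₄ * (3 * 4 !) ^ n₅
    * (n₂ ! / (n₂ / 2) !) {{ (n₂ / 2) !≢0 }}
    * ((n₂ / 2 + m ∸ 1) ! / (n₂ / 2 ∸ 1) !) {{ (n₂ / 2 ∸ 1) !≢0 }}
    * (n₂ / 2 + n₃ + n₄ + n₅ + w ∸ 1) ! )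
theorem1p1 _ n₃ n₄ n₅ m w (divides (suc r) ≡.refl) _ =
  subst (HasCardinality _) (Circle.formula r n₃ n₄ n₅ m w (suc r * 2 / 2) (m*n/n≡m (suc r) 2))
    (Circle.seatings-count r n₃ n₄ n₅ m w)
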